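{- Let $b\geq0$ be an integer. Introducing the first-order linear partial differential operators $$D^{\mathrm{str}}=\frac{\partial}{\partial\hat x_1}-\sum_{\ell=0}^\infty\hat x_\ell\left(-\ell\frac{\partial}{\partial\hat x_\ell}+\sum_{k=1}^\ell2k\frac{\partial}{\partial\hat x_k}-\sum_{k=1}^b2k\frac{\partial}{\partial\hat x_k}\right),$$ $$D^{\mathrm{dil}}=\frac{\partial}{\partial\hat x_1}-\frac{\partial}{\partial\hat x_0}-\sum_{\ell=0}^\infty\hat x_\ell\frac{\partial}{\partial\hat x_\ell},$$ we have $$D^{\mathrm{str}}\check R^{(b)}=1+\check R^{(b)},\qquad D^{\mathrm{dil}}\check R^{(b)}=0.$$
   Context: Define the formal power series in $r$ $$I(b,\ell;r)=\sum_{p=0}^\infty\frac{r^p}{(p!)^2}\prod_{m=0}^{p-1}(\ell^2-(b-m)^2),\qquad J(b;r)=\sum_{p=1}^\infty\frac{(-1)^{p+1}r^p}{p!(p-1)!}\prod_{m=0}^{p-2}(b-m)(b-m-1),$$ and $\check Z^{(b)}(r;\hat x_0,\hat x_1,\ldots)=J(b;r)-\sum_{\ell=0}^\infty I(b,\ell;r)\hat x_\ell$. $\check R^{(b)}(\hat x_0,\hat x_1,\ldots)$ is the unique formal power series with zero constant term satisfying $\check Z^{(b)}(\check R^{(b)};\hat x_0,\hat x_1,\ldots)=0$. -}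

module Defs where

open import Data.Nat.Base as ℕ using (ℕ; zero; suc; _∸_; _!)
import Data.Nat.ListAction as ListAction
open import Data.Nat.ListAction.Properties using (sum-++)
import Data.Nat.Properties as ℕₚ
open import Data.Integer.Base as ℤ using (ℤ; +_; 1ℤ; -1ℤ)
import Data.Integer.Properties as ℤₚ
open import Data.Rational.Base using (ℚ; 0ℚ; 1ℚ; _+_; _-_; _*_; -_; _/_)
import Data.Rational.Properties as ℚₚ
open import Data.Fin.Base using (toℕ)
open import Data.List.Base using (List; []; _∷_; _∷ʳ_; length)
open import Function.Base using (_∘_)
open import Relation.Binary.PropositionalEquality
  using (_≡_; refl; trans; cong; cong₂)
import Algebra.Properties.Monoid.Sum ℚₚ.+-0-monoid as ∑ℚ
import Algebra.Properties.Monoid.Sum ℤₚ.*-1-monoid as ∏ℤ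

-- Sum and product over 0 ≤ i < n.

∑< : ℕ → (ℕ → ℚ) → ℚ
∑< n f = ∑ℚ.sum {n} (f ∘ toℕ)

∏< : ℕ → (ℕ → ℤ) → ℤ
∏< n f = ∏ℤ.sum {n} (f ∘ toℕ)

∑<-cong : ∀ n {f g : ℕ → ℚ} → (∀ i → f i ≡ g i) → ∑< n f ≡ ∑< n g
∑<-cong n f≗g = ∑ℚ.sum-cong-≗ {n} (f≗g ∘ toℕ)

-- PowerSeries is ℚ[[x̂₀, x̂₁, …]].  The list a₀ ∷ … ∷ aₙ ∷ [] is the
-- exponent sequence of x̂₀^a₀ ⋯ x̂ₙ^aₙ.  Lists that differ only by trailing
-- zeros are the same monomial, hence the field `pad` of PowerSeries.

Monomial : Set
Monomial = List ℕ

degree : Monomial → ℕ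
degree = ListAction.sum

Coefficients : Set
Coefficients = Monomial → ℚ

Padded : Coefficients → Set
Padded F = ∀ m → F (m ∷ʳ 0) ≡ F m

record PowerSeries : Set where
  constructor mkPowerSeries
  field
    coeff : Coefficients
    pad   : Padded coeff

open PowerSeries public

infix 4 _≈ˢ_

_≈ˢ_ : PowerSeries → PowerSeries → Set
F ≈ˢ G = ∀ m → coeff F m ≡ coeff G m

constantTerm : PowerSeries → ℚ
constantTerm F = coeff F []

-- F ∘ (a ∷_) lists the coefficients of x̂₀^a in F, as a series in the
-- remaining variables x̂₁, x̂₂, …, reindexed to start from 0.

constᶜ : ℚ → Coefficients
constᶜ c []          = c
constᶜ c (zero  ∷ m) = constᶜ c m
constᶜ c (suc _ ∷ m) = 0ℚ

mulᶜ : Coefficients → Coefficients → Coefficients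
mulᶜ F G []      = F [] * G []
mulᶜ F G (a ∷ m) = ∑< (suc a) λ i → mulᶜ (F ∘ (i ∷_)) (G ∘ ((a ∸ i) ∷_)) m

-- multiplication by x̂ ℓ

shiftᶜ : ℕ → Coefficients → Coefficients
shiftᶜ _       F []          = 0ℚ
shiftᶜ zero    F (zero  ∷ m) = 0ℚ
shiftᶜ zero    F (suc a ∷ m) = F (a ∷ m)
shiftᶜ (suc ℓ) F (a ∷ m)     = shiftᶜ ℓ (F ∘ (a ∷_)) m

-- ∂/∂x̂ ℓ : the coefficient of m in the derivative is (m ℓ + 1) times
-- the coefficient of x̂ ℓ · m.

exponent : ℕ → Monomial → ℕ
exponent _       []      = 0
exponent zero    (a ∷ m) = a
exponent (suc ℓ) (a ∷ m) = exponent ℓ m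

raise : ℕ → Monomial → Monomial
raise zero    []      = 1 ∷ []
raise zero    (a ∷ m) = suc a ∷ m
raise (suc ℓ) []      = 0 ∷ raise ℓ []
raise (suc ℓ) (a ∷ m) = a ∷ raise ℓ m

∂ᶜ : ℕ → Coefficients → Coefficients
∂ᶜ ℓ F m = (+ suc (exponent ℓ m) / 1) * F (raise ℓ m)

-- Only finitely many of the series x̂ ℓ · G ℓ contain a given monomial m:
-- x̂ ℓ does not divide m once ℓ ≥ length m.

∑x̂ᶜ : (ℕ → Coefficients) → Coefficients
∑x̂ᶜ G m = ∑< (length m) λ ℓ → shiftᶜ ℓ (G ℓ) m

constᶜ-pad : ∀ c → Padded (constᶜ c)
constᶜ-pad c []          = refl
constᶜ-pad c (zero  ∷ m) = constᶜ-pad c m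
constᶜ-pad c (suc _ ∷ m) = refl

mulᶜ-pad : ∀ {F G} → Padded F → Padded G → Padded (mulᶜ F G)
mulᶜ-pad F-pad G-pad [] =
  trans (ℚₚ.+-identityʳ _) (cong₂ _*_ (F-pad []) (G-pad []))
mulᶜ-pad F-pad G-pad (a ∷ m) =
  ∑<-cong (suc a) λ i →
    mulᶜ-pad (F-pad ∘ (i ∷_)) (G-pad ∘ ((a ∸ i) ∷_)) m

shiftᶜ-pad : ∀ ℓ {F} → Padded F → Padded (shiftᶜ ℓ F)
shiftᶜ-pad zero    F-pad []          = refl
shiftᶜ-pad (suc ℓ) F-pad []          = refl
shiftᶜ-pad zero    F-pad (zero  ∷ m) = refl
shiftᶜ-pad zero    F-pad (suc a ∷ m) = F-pad (a ∷ m)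
shiftᶜ-pad (suc ℓ) F-pad (a ∷ m)     = shiftᶜ-pad ℓ (F-pad ∘ (a ∷_)) m

exponent-pad : ∀ ℓ m → exponent ℓ (m ∷ʳ 0) ≡ exponent ℓ m
exponent-pad zero    []      = refl
exponent-pad (suc ℓ) []      = refl
exponent-pad zero    (a ∷ m) = refl
exponent-pad (suc ℓ) (a ∷ m) = exponent-pad ℓ m

raise-pad : ∀ ℓ {F} → Padded F → ∀ m → F (raise ℓ (m ∷ʳ 0)) ≡ F (raise ℓ m)
raise-pad zero    F-pad []      = refl
raise-pad (suc ℓ) F-pad []      = refl
raise-pad zero    F-pad (a ∷ m) = F-pad (suc a ∷ m)
raise-pad (suc ℓ) F-pad (a ∷ m) = raise-pad ℓ (F-pad ∘ (a ∷_)) m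

∂ᶜ-pad : ∀ ℓ {F} → Padded F → Padded (∂ᶜ ℓ F)
∂ᶜ-pad ℓ F-pad m =
  cong₂ (λ e c → (+ suc e / 1) * c) (exponent-pad ℓ m) (raise-pad ℓ F-pad m)

∑x̂ᶜ-pad : ∀ {G} → (∀ ℓ → Padded (G ℓ)) → Padded (∑x̂ᶜ G)
∑x̂ᶜ-pad G-pad []      = refl
∑x̂ᶜ-pad G-pad (a ∷ m) =
  cong₂ _+_ (shiftᶜ-pad zero (G-pad 0) (a ∷ m))
            (∑x̂ᶜ-pad (λ ℓ → G-pad (suc ℓ) ∘ (a ∷_)) m)

degree-pad : ∀ m → degree (m ∷ʳ 0) ≡ degree m
degree-pad m = trans (sum-++ m (0 ∷ [])) (ℕₚ.+-identityʳ _)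

infixl 6 _+ˢ_ _-ˢ_
infixl 7 _*ˢ_
infixr 8 _·ˢ_
infixr 9 _^ˢ_

const : ℚ → PowerSeries
const c = mkPowerSeries (constᶜ c) (constᶜ-pad c)

0ˢ 1ˢ : PowerSeries
0ˢ = const 0ℚ
1ˢ = const 1ℚ

_+ˢ_ _-ˢ_ _*ˢ_ : PowerSeries → PowerSeries → PowerSeries
F +ˢ G = mkPowerSeries (λ m → coeff F m + coeff G m)
                       (λ m → cong₂ _+_ (pad F m) (pad G m))
F -ˢ G = mkPowerSeries (λ m → coeff F m - coeff G m)
                       (λ m → cong₂ _-_ (pad F m) (pad G m))
F *ˢ G = mkPowerSeries (mulᶜ (coeff F) (coeff G)) (mulᶜ-pad (pad F) (pad G))

_·ˢ_ : ℚ → PowerSeries → PowerSeries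
c ·ˢ F = mkPowerSeries (λ m → c * coeff F m) (λ m → cong (c *_) (pad F m))

_^ˢ_ : PowerSeries → ℕ → PowerSeries
F ^ˢ zero  = 1ˢ
F ^ˢ suc n = F *ˢ F ^ˢ n

∂ : ℕ → PowerSeries → PowerSeries
∂ ℓ F = mkPowerSeries (∂ᶜ ℓ (coeff F)) (∂ᶜ-pad ℓ (pad F))

-- ∑ˢ[1… n ] F = F 1 + ⋯ + F n

∑ˢ[1…_] : ℕ → (ℕ → PowerSeries) → PowerSeries
∑ˢ[1… n ] F = mkPowerSeries
  (λ m → ∑< n λ k → coeff (F (suc k)) m)
  (λ m → ∑<-cong n λ k → pad (F (suc k)) m)

-- ∑x̂ G = ∑_{ℓ ≥ 0} x̂ ℓ · G ℓ

∑x̂ : (ℕ → PowerSeries) → PowerSeries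
∑x̂ G = mkPowerSeries (∑x̂ᶜ (coeff ∘ G)) (∑x̂ᶜ-pad (pad ∘ G))

-- Power series in r, given by their coefficient sequences.

_[[r]] : Set → Set
A [[r]] = ℕ → A

-- Substitution of r = R.  Meaningful only for R with zero constant term:
-- R ^ˢ p then has no monomials of degree below p, so that ∑_p Z p · R^p is,
-- in degree d, the finite sum over p ≤ d.

_⟦r≔_⟧ : PowerSeries [[r]] → PowerSeries → PowerSeries
Z ⟦r≔ R ⟧ = mkPowerSeries
  (λ m → ∑< (suc (degree m)) λ p → coeff (Z p *ˢ R ^ˢ p) m)
  (λ m → trans
    (cong (λ d → ∑< (suc d) λ p → coeff (Z p *ˢ R ^ˢ p) (m ∷ʳ 0)) (degree-pad m))
    (∑<-cong (suc (degree m)) λ p → pad (Z p *ˢ R ^ˢ p) m))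

I : (b ℓ : ℕ) → ℚ [[r]]
I b ℓ p = _/_
  (∏< p λ m → + ℓ ℤ.* + ℓ ℤ.- (+ b ℤ.- + m) ℤ.* (+ b ℤ.- + m))
  (p ! ℕ.* p !) {{p ℕₚ.!* p !≢0}}

-- With p = suc q, the product over 0 ≤ m ≤ p - 2 has q factors.

J : ℕ → ℚ [[r]]
J b zero      = 0ℚ
J b p@(suc q) = _/_
  (-1ℤ ℤ.^ suc p ℤ.* ∏< q λ m → (+ b ℤ.- + m) ℤ.* (+ b ℤ.- + m ℤ.- 1ℤ))
  (p ! ℕ.* q !) {{p ℕₚ.!* q !≢0}}

Ž : ℕ → PowerSeries [[r]]
Ž b p = const (J b p) -ˢ ∑x̂ (λ ℓ → const (I b ℓ p))

record IsŘ (b : ℕ) (R : PowerSeries) : Set where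
  field
    zeroConstantTerm : constantTerm R ≡ 0ℚ
    root             : Ž b ⟦r≔ R ⟧ ≈ˢ 0ˢ

D-str : ℕ → PowerSeries → PowerSeries
D-str b F = ∂ 1 F -ˢ ∑x̂ λ ℓ →
  (- (+ ℓ / 1)) ·ˢ ∂ ℓ F
    +ˢ ∑ˢ[1… ℓ ] (λ k → (+ (2 ℕ.* k) / 1) ·ˢ ∂ k F)
    -ˢ ∑ˢ[1… b ] (λ k → (+ (2 ℕ.* k) / 1) ·ˢ ∂ k F)

D-dil : PowerSeries → PowerSeries
D-dil F = ∂ 1 F -ˢ ∂ 0 F -ˢ ∑x̂ λ ℓ → ∂ ℓ F

{-# OPTIONS --safe #-}
module Submission where

-- Write S(a) = ∑_p a_p R^p for a scalar series a(r), and W = ∂Ž/∂r at r = R.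
-- The root equation reads S(J) = ∑_ℓ x̂_ℓ S(I_ℓ); applying ∂/∂x̂_k to it gives
-- W · ∂R/∂x̂_k = S(I_k).  As W has constant term 1 it is cancellable, so it
-- suffices to check both equations after multiplication by W.  There they
-- follow from three scalar identities and the root equation itself:
--   J = I_1 - I_0,
--   (1 + r) J′ = I_1 + b J,
--   (1 + r) I_ℓ′ = (b - ℓ) I_ℓ + ∑_{k=1}^ℓ 2k I_k - ∑_{k=1}^b 2k I_k.

open import Defs
import Algebra.Properties.CommutativeSemigroup as CommutativeSemigroup
import Algebra.Properties.Semiring.Sum as SemiringSum
open import Algebra.Bundles using (CommutativeRing)
open import Data.Fin.Base using (toℕ)
open import Data.Integer.Base as ℤ using (ℤ; +_; -1ℤ)
import Data.Integer.Properties as ℤₚ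
open import Data.List.Base using ([]; _∷_; length)
open import Data.Nat.Base as ℕ using (ℕ; zero; suc; _∸_; _≤_; _<_; z≤n; s≤s; _!)
import Data.Nat.Properties as ℕₚ
open import Data.Product.Base using (_×_; _,_)
open import Data.Rational.Base using (ℚ; 0ℚ; 1ℚ; _+_; _-_; _*_; -_; _/_; 1/_; NonZero; fromℚᵘ)
import Data.Rational.Properties as ℚₚ
open import Data.Rational.Solver using (module +-*-Solver)
open import Data.Rational.Unnormalised.Base using (mkℚᵘ; *≡*) renaming (_+_ to _+ᵘ_; _*_ to _*ᵘ_)
import Data.Rational.Unnormalised.Properties as ℚᵘₚ
open import Function.Base using (_∘_)
open import Relation.Binary.PropositionalEquality using (_≡_; _≗_; refl; sym; trans; cong; cong₂; subst; module ≡-Reasoning)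
open import Relation.Nullary using (yes; no)
open +-*-Solver using (solve; _:=_; con; _:+_; _:-_; _:*_; :-_)
open ≡-Reasoning

module ℕ-+ = CommutativeSemigroup ℕₚ.+-commutativeSemigroup
module ∑ℚ = SemiringSum (CommutativeRing.semiring ℚₚ.+-*-commutativeRing)

∏<-snoc : ∀ n f → ∏< (suc n) f ≡ ∏< n f ℤ.* f n
∏<-snoc zero    f = ℤₚ.*-comm (f 0) _
∏<-snoc (suc n) f = trans (cong (f 0 ℤ.*_) (∏<-snoc n (f ∘ suc)))
  (sym (ℤₚ.*-assoc (f 0) (∏< n (f ∘ suc)) (f (suc n))))

∑<-snoc : ∀ n f → ∑< (suc n) f ≡ ∑< n f + f n
∑<-snoc zero    f = ℚₚ.+-comm (f 0) _
∑<-snoc (suc n) f = trans (cong (λ z → f 0 + z) (∑<-snoc n (f ∘ suc)))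
  (sym (ℚₚ.+-assoc (f 0) (∑< n (f ∘ suc)) (f (suc n))))

fromℤ : ℤ → ℚ
fromℤ i = i / 1

ι : ℕ → ℚ
ι n = fromℤ (+ n)

fromℚᵘ-+ : ∀ p q → fromℚᵘ (p +ᵘ q) ≡ fromℚᵘ p + fromℚᵘ q
fromℚᵘ-+ p q = ℚₚ.toℚᵘ-injective (ℚᵘₚ.≃-trans (ℚₚ.toℚᵘ-fromℚᵘ (p +ᵘ q)) (ℚᵘₚ.≃-sym
  (ℚᵘₚ.≃-trans (ℚₚ.toℚᵘ-homo-+ (fromℚᵘ p) (fromℚᵘ q))
               (ℚᵘₚ.+-cong (ℚₚ.toℚᵘ-fromℚᵘ p) (ℚₚ.toℚᵘ-fromℚᵘ q)))))

fromℚᵘ-* : ∀ p q → fromℚᵘ (p *ᵘ q) ≡ fromℚᵘ p * fromℚᵘ q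
fromℚᵘ-* p q = ℚₚ.toℚᵘ-injective (ℚᵘₚ.≃-trans (ℚₚ.toℚᵘ-fromℚᵘ (p *ᵘ q)) (ℚᵘₚ.≃-sym
  (ℚᵘₚ.≃-trans (ℚₚ.toℚᵘ-homo-* (fromℚᵘ p) (fromℚᵘ q))
               (ℚᵘₚ.*-cong (ℚₚ.toℚᵘ-fromℚᵘ p) (ℚₚ.toℚᵘ-fromℚᵘ q)))))

fromℤ-+ : ∀ i j → fromℤ (i ℤ.+ j) ≡ fromℤ i + fromℤ j
fromℤ-+ i j = trans
  (cong fromℤ (sym (cong₂ ℤ._+_ (ℤₚ.*-identityʳ i) (ℤₚ.*-identityʳ j))))
  (fromℚᵘ-+ (mkℚᵘ i 0) (mkℚᵘ j 0))

fromℤ-* : ∀ i j → fromℤ (i ℤ.* j) ≡ fromℤ i * fromℤ j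
fromℤ-* i j = fromℚᵘ-* (mkℚᵘ i 0) (mkℚᵘ j 0)

fromℤ-neg : ∀ i → fromℤ (ℤ.- i) ≡ - fromℤ i
fromℤ-neg i = begin
  fromℤ (ℤ.- i)              ≡⟨ cong fromℤ (sym (ℤₚ.-1*i≡-i i)) ⟩
  fromℤ (-1ℤ ℤ.* i)          ≡⟨ fromℤ-* -1ℤ i ⟩
  - 1ℚ * fromℤ i             ≡⟨ solve 1 (λ x → con (- 1ℚ) :* x := :- x) refl (fromℤ i) ⟩
  - fromℤ i                  ∎

fromℤ-∸ : ∀ i j → fromℤ (i ℤ.- j) ≡ fromℤ i - fromℤ j
fromℤ-∸ i j = trans (fromℤ-+ i (ℤ.- j)) (cong (λ z → fromℤ i + z) (fromℤ-neg j))

ι-suc : ∀ n → ι (suc n) ≡ 1ℚ + ι n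
ι-suc n = fromℤ-+ (+ 1) (+ n)

ι-* : ∀ m n → ι (m ℕ.* n) ≡ ι m * ι n
ι-* m n = trans (cong fromℤ (ℤₚ.pos-* m n)) (fromℤ-* (+ m) (+ n))

/-*-ι : ∀ i n .{{_ : ℕ.NonZero n}} → (i / n) * ι n ≡ fromℤ i
/-*-ι i (suc n) = trans (sym (fromℚᵘ-* (mkℚᵘ i n) (mkℚᵘ (+ suc n) 0)))
  (ℚₚ.fromℚᵘ-cong {mkℚᵘ i n *ᵘ mkℚᵘ (+ suc n) 0} {mkℚᵘ i 0} (*≡* (trans (ℤₚ.*-identityʳ _)
    (cong (i ℤ.*_) (cong +_ (sym (ℕₚ.*-identityʳ (suc n))))))))

ι-nonZero : ∀ n .{{_ : ℕ.NonZero n}} → NonZero (ι n)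
ι-nonZero n = ℚₚ.pos⇒nonZero (ι n) {{ℚₚ.normalize-pos n 1}}

*-cancelˡ : ∀ c .{{_ : NonZero c}} {x y} → c * x ≡ c * y → x ≡ y
*-cancelˡ c {x} {y} cx≡cy = trans (sym (inv x)) (trans (cong ((1/ c) *_) cx≡cy) (inv y))
  where
  inv : ∀ z → (1/ c) * (c * z) ≡ z
  inv z = trans (sym (ℚₚ.*-assoc (1/ c) c z))
    (trans (cong (_* z) (ℚₚ.*-inverseˡ c)) (ℚₚ.*-identityˡ z))

ι-cancelˡ : ∀ n .{{_ : ℕ.NonZero n}} {x y} → ι n * x ≡ ι n * y → x ≡ y
ι-cancelˡ n = *-cancelˡ (ι n) {{ι-nonZero n}}

I-rec : ∀ b ℓ p → ι (suc p) * ι (suc p) * I b ℓ (suc p)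
              ≡ (ι ℓ * ι ℓ - (ι b - ι p) * (ι b - ι p)) * I b ℓ p
I-rec b ℓ p = ι-cancelˡ (p ! ℕ.* p !) {{p ℕₚ.!* p !≢0}} (begin
  d * (s * s * I b ℓ (suc p))
    ≡⟨ solve 3 (λ d s x → d :* (s :* s :* x) := x :* (s :* s :* d)) refl d s (I b ℓ (suc p)) ⟩
  I b ℓ (suc p) * (s * s * d)
    ≡⟨ cong (I b ℓ (suc p) *_) (sym den) ⟩
  I b ℓ (suc p) * ι (suc p ! ℕ.* suc p !)
    ≡⟨ /-*-ι (∏< (suc p) f) (suc p ! ℕ.* suc p !) {{suc p ℕₚ.!* suc p !≢0}} ⟩
  fromℤ (∏< (suc p) f)
    ≡⟨ trans (cong fromℤ (∏<-snoc p f)) (fromℤ-* (∏< p f) (f p)) ⟩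
  fromℤ (∏< p f) * fromℤ (f p)
    ≡⟨ cong₂ _*_ (sym (/-*-ι (∏< p f) (p ! ℕ.* p !) {{p ℕₚ.!* p !≢0}})) factor ⟩
  I b ℓ p * d * (ι ℓ * ι ℓ - (ι b - ι p) * (ι b - ι p))
    ≡⟨ solve 3 (λ x d c → x :* d :* c := d :* (c :* x)) refl (I b ℓ p) d _ ⟩
  d * ((ι ℓ * ι ℓ - (ι b - ι p) * (ι b - ι p)) * I b ℓ p) ∎)
  where
  d s : ℚ
  d = ι (p ! ℕ.* p !)
  s = ι (suc p)
  f : ℕ → ℤ
  f m = + ℓ ℤ.* + ℓ ℤ.- (+ b ℤ.- + m) ℤ.* (+ b ℤ.- + m)
  den : ι (suc p ! ℕ.* suc p !) ≡ s * s * d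
  den = begin
    ι (suc p ! ℕ.* suc p !)                ≡⟨ ι-* (suc p !) (suc p !) ⟩
    ι (suc p !) * ι (suc p !)              ≡⟨ cong₂ _*_ (ι-* (suc p) (p !)) (ι-* (suc p) (p !)) ⟩
    (s * ι (p !)) * (s * ι (p !))          ≡⟨ solve 2 (λ s x → (s :* x) :* (s :* x) := s :* s :* (x :* x)) refl s (ι (p !)) ⟩
    s * s * (ι (p !) * ι (p !))            ≡⟨ cong (s * s *_) (sym (ι-* (p !) (p !))) ⟩
    s * s * d                              ∎
  factor : fromℤ (f p) ≡ ι ℓ * ι ℓ - (ι b - ι p) * (ι b - ι p)
  factor = trans (fromℤ-∸ (+ ℓ ℤ.* + ℓ) _) (cong₂ _-_ (fromℤ-* (+ ℓ) (+ ℓ))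
    (trans (fromℤ-* (+ b ℤ.- + p) (+ b ℤ.- + p)) (cong₂ _*_ (fromℤ-∸ (+ b) (+ p)) (fromℤ-∸ (+ b) (+ p)))))

J-rec : ∀ b q → ι (suc (suc q)) * ι (suc q) * J b (suc (suc q))
              ≡ - ((ι b - ι q) * (ι b - ι q - 1ℚ)) * J b (suc q)
J-rec b q = ι-cancelˡ (suc q ! ℕ.* q !) {{suc q ℕₚ.!* q !≢0}} (begin
  d * (s * t * J b (suc (suc q)))
    ≡⟨ solve 4 (λ d s t x → d :* (s :* t :* x) := x :* (s :* t :* d)) refl d s t (J b (suc (suc q))) ⟩
  J b (suc (suc q)) * (s * t * d)
    ≡⟨ cong (J b (suc (suc q)) *_) (sym den) ⟩
  J b (suc (suc q)) * ι (suc (suc q) ! ℕ.* suc q !)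
    ≡⟨ /-*-ι (num (suc q)) (suc (suc q) ! ℕ.* suc q !) {{suc (suc q) ℕₚ.!* suc q !≢0}} ⟩
  fromℤ (num (suc q))
    ≡⟨ numerator ⟩
  fromℤ (num q) * - (x * (x - 1ℚ))
    ≡⟨ cong (_* - (x * (x - 1ℚ))) (sym (/-*-ι (num q) (suc q ! ℕ.* q !) {{suc q ℕₚ.!* q !≢0}})) ⟩
  J b (suc q) * d * - (x * (x - 1ℚ))
    ≡⟨ solve 3 (λ y d c → y :* d :* :- c := d :* (:- c :* y)) refl (J b (suc q)) d _ ⟩
  d * (- (x * (x - 1ℚ)) * J b (suc q)) ∎)
  where
  d s t x : ℚ
  d = ι (suc q ! ℕ.* q !)
  s = ι (suc (suc q))
  t = ι (suc q)
  x = ι b - ι q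
  f : ℕ → ℤ
  f m = (+ b ℤ.- + m) ℤ.* (+ b ℤ.- + m ℤ.- + 1)
  num : ℕ → ℤ
  num q = -1ℤ ℤ.^ suc (suc q) ℤ.* ∏< q f
  den : ι (suc (suc q) ! ℕ.* suc q !) ≡ s * t * d
  den = begin
    ι (suc (suc q) ! ℕ.* suc q !)          ≡⟨ ι-* (suc (suc q) !) (suc q !) ⟩
    ι (suc (suc q) !) * ι (suc q !)        ≡⟨ cong₂ _*_ (ι-* (suc (suc q)) (suc q !)) (ι-* (suc q) (q !)) ⟩
    (s * ι (suc q !)) * (t * ι (q !))      ≡⟨ solve 4 (λ s t x y → (s :* x) :* (t :* y) := s :* t :* (x :* y)) refl s t (ι (suc q !)) (ι (q !)) ⟩
    s * t * (ι (suc q !) * ι (q !))        ≡⟨ cong (s * t *_) (sym (ι-* (suc q !) (q !))) ⟩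
    s * t * d                              ∎
  factor : fromℤ (f q) ≡ x * (x - 1ℚ)
  factor = trans (fromℤ-* (+ b ℤ.- + q) _) (cong₂ _*_ (fromℤ-∸ (+ b) (+ q))
    (trans (fromℤ-∸ (+ b ℤ.- + q) (+ 1)) (cong (_- 1ℚ) (fromℤ-∸ (+ b) (+ q)))))
  numerator : fromℤ (num (suc q)) ≡ fromℤ (num q) * - (x * (x - 1ℚ))
  numerator = begin
    fromℤ (-1ℤ ℤ.* e ℤ.* ∏< (suc q) f)
      ≡⟨ cong (λ z → fromℤ (-1ℤ ℤ.* e ℤ.* z)) (∏<-snoc q f) ⟩
    fromℤ (-1ℤ ℤ.* e ℤ.* (∏< q f ℤ.* f q))
      ≡⟨ trans (fromℤ-* (-1ℤ ℤ.* e) _) (cong₂ _*_ (fromℤ-* -1ℤ e) (fromℤ-* (∏< q f) (f q))) ⟩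
    - 1ℚ * fromℤ e * (fromℤ (∏< q f) * fromℤ (f q))
      ≡⟨ solve 3 (λ u v w → con (- 1ℚ) :* u :* (v :* w) := u :* v :* :- w) refl (fromℤ e) (fromℤ (∏< q f)) (fromℤ (f q)) ⟩
    fromℤ e * fromℤ (∏< q f) * - fromℤ (f q)
      ≡⟨ cong₂ (λ u v → u * - v) (sym (fromℤ-* e (∏< q f))) factor ⟩
    fromℤ (num q) * - (x * (x - 1ℚ)) ∎
    where
    e : ℤ
    e = -1ℤ ℤ.^ suc (suc q)

-- Recurrences and contiguity relations of I and J

deriv : ℚ [[r]] → ℚ [[r]]
deriv a p = ι (suc p) * a (suc p)

r·_ : ℚ [[r]] → ℚ [[r]]
(r· a) zero    = 0ℚ
(r· a) (suc p) = a p

r·deriv : ∀ a p → (r· deriv a) p ≡ ι p * a p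
r·deriv a zero    = sym (ℚₚ.*-zeroˡ (a 0))
r·deriv a (suc p) = refl

I₁-J : ∀ b p → ι p * I b 1 p ≡ - ((ι b + 1ℚ) * (ι b - ι p)) * J b p
I₁-J b zero          = solve 1 (λ B → con 0ℚ :* con 1ℚ := :- ((B :+ con 1ℚ) :* (B :- con 0ℚ)) :* con 0ℚ) refl (ι b)
I₁-J b (suc zero)    = begin
  1ℚ * I b 1 1                       ≡⟨ solve 1 (λ x → con 1ℚ :* x := con 1ℚ :* con 1ℚ :* x) refl (I b 1 1) ⟩
  1ℚ * 1ℚ * I b 1 1                  ≡⟨ I-rec b 1 0 ⟩
  (1ℚ * 1ℚ - (ι b - 0ℚ) * (ι b - 0ℚ)) * 1ℚ
    ≡⟨ solve 1 (λ B → (con 1ℚ :* con 1ℚ :- (B :- con 0ℚ) :* (B :- con 0ℚ)) :* con 1ℚ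
                   := :- ((B :+ con 1ℚ) :* (B :- con 1ℚ)) :* con 1ℚ) refl (ι b) ⟩
  - ((ι b + 1ℚ) * (ι b - 1ℚ)) * J b 1 ∎
I₁-J b (suc p@(suc q)) = ι-cancelˡ (suc p) (ι-cancelˡ p (begin
  P * (P′ * (P′ * x′))
    ≡⟨ solve 3 (λ P P′ x → P :* (P′ :* (P′ :* x)) := P :* (P′ :* P′ :* x)) refl P P′ x′ ⟩
  P * (P′ * P′ * x′)
    ≡⟨ cong (P *_) (I-rec b 1 p) ⟩
  P * ((1ℚ * 1ℚ - (B - P) * (B - P)) * x)
    ≡⟨ solve 3 (λ P c x → P :* (c :* x) := c :* (P :* x)) refl P (1ℚ * 1ℚ - (B - P) * (B - P)) x ⟩
  (1ℚ * 1ℚ - (B - P) * (B - P)) * (P * x)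
    ≡⟨ cong ((1ℚ * 1ℚ - (B - P) * (B - P)) *_) (I₁-J b p) ⟩
  (1ℚ * 1ℚ - (B - P) * (B - P)) * (- ((B + 1ℚ) * (B - P)) * y)
    ≡⟨ cong (λ P → (1ℚ * 1ℚ - (B - P) * (B - P)) * (- ((B + 1ℚ) * (B - P)) * y)) (ι-suc q) ⟩
  (1ℚ * 1ℚ - (B - (1ℚ + Q)) * (B - (1ℚ + Q))) * (- ((B + 1ℚ) * (B - (1ℚ + Q))) * y)
    ≡⟨ solve 3 (λ B Q y →
         (con 1ℚ :* con 1ℚ :- (B :- (con 1ℚ :+ Q)) :* (B :- (con 1ℚ :+ Q)))
           :* (:- ((B :+ con 1ℚ) :* (B :- (con 1ℚ :+ Q))) :* y)
         := :- ((B :+ con 1ℚ) :* (B :- (con 1ℚ :+ (con 1ℚ :+ Q))))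
           :* (:- ((B :- Q) :* (B :- Q :- con 1ℚ)) :* y)) refl B Q y ⟩
  - ((B + 1ℚ) * (B - (1ℚ + (1ℚ + Q)))) * (- ((B - Q) * (B - Q - 1ℚ)) * y)
    ≡⟨ cong₂ (λ u v → - ((B + 1ℚ) * (B - u)) * v)
         (trans (cong (λ z → 1ℚ + z) (sym (ι-suc q))) (sym (ι-suc p))) (sym (J-rec b q)) ⟩
  - ((B + 1ℚ) * (B - P′)) * (P′ * P * y′)
    ≡⟨ solve 4 (λ c P P′ y → c :* (P′ :* P :* y) := P :* (P′ :* (c :* y))) refl (- ((B + 1ℚ) * (B - P′))) P P′ y′ ⟩
  P * (P′ * (- ((B + 1ℚ) * (B - P′)) * y′)) ∎))
  where
  B Q P P′ x x′ y y′ : ℚ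
  B = ι b
  Q = ι q
  P = ι p
  P′ = ι (suc p)
  x = I b 1 p
  x′ = I b 1 (suc p)
  y = J b p
  y′ = J b (suc p)

J≡I₁-I₀ : ∀ b p → J b p ≡ I b 1 p - I b 0 p
J≡I₁-I₀ b zero       = refl
J≡I₁-I₀ b (suc zero) = sym (begin
  I b 1 1 - I b 0 1
    ≡⟨ solve 2 (λ x y → x :- y := con 1ℚ :* con 1ℚ :* x :- con 1ℚ :* con 1ℚ :* y) refl (I b 1 1) (I b 0 1) ⟩
  1ℚ * 1ℚ * I b 1 1 - 1ℚ * 1ℚ * I b 0 1
    ≡⟨ cong₂ _-_ (I-rec b 1 0) (I-rec b 0 0) ⟩
  (1ℚ * 1ℚ - (ι b - 0ℚ) * (ι b - 0ℚ)) * 1ℚ - (0ℚ * 0ℚ - (ι b - 0ℚ) * (ι b - 0ℚ)) * 1ℚ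
    ≡⟨ solve 1 (λ B → (con 1ℚ :* con 1ℚ :- (B :- con 0ℚ) :* (B :- con 0ℚ)) :* con 1ℚ
                   :- (con 0ℚ :* con 0ℚ :- (B :- con 0ℚ) :* (B :- con 0ℚ)) :* con 1ℚ
                   := con 1ℚ) refl (ι b) ⟩
  1ℚ ∎)
J≡I₁-I₀ b (suc p@(suc q)) = sym (ι-cancelˡ (suc p) (ι-cancelˡ (suc p) (ι-cancelˡ p (begin
  P * (P′ * (P′ * (x′ - z′)))
    ≡⟨ solve 4 (λ P P′ x z → P :* (P′ :* (P′ :* (x :- z))) := P :* (P′ :* P′ :* x :- P′ :* P′ :* z)) refl P P′ x′ z′ ⟩
  P * (P′ * P′ * x′ - P′ * P′ * z′)
    ≡⟨ cong (P *_) (cong₂ _-_ (I-rec b 1 p) (I-rec b 0 p)) ⟩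
  P * ((1ℚ * 1ℚ - (B - P) * (B - P)) * x - (0ℚ * 0ℚ - (B - P) * (B - P)) * z)
    ≡⟨ solve 4 (λ B P x z →
         P :* ((con 1ℚ :* con 1ℚ :- (B :- P) :* (B :- P)) :* x :- (con 0ℚ :* con 0ℚ :- (B :- P) :* (B :- P)) :* z)
         := P :* x :- (B :- P) :* (B :- P) :* (P :* (x :- z))) refl B P x z ⟩
  P * x - (B - P) * (B - P) * (P * (x - z))
    ≡⟨ cong₂ (λ u v → u - (B - P) * (B - P) * (P * v)) (I₁-J b p) (sym (J≡I₁-I₀ b p)) ⟩
  - ((B + 1ℚ) * (B - P)) * y - (B - P) * (B - P) * (P * y)
    ≡⟨ cong (λ P → - ((B + 1ℚ) * (B - P)) * y - (B - P) * (B - P) * (P * y)) (ι-suc q) ⟩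
  - ((B + 1ℚ) * (B - (1ℚ + Q))) * y - (B - (1ℚ + Q)) * (B - (1ℚ + Q)) * ((1ℚ + Q) * y)
    ≡⟨ solve 3 (λ B Q y →
         :- ((B :+ con 1ℚ) :* (B :- (con 1ℚ :+ Q))) :* y
           :- (B :- (con 1ℚ :+ Q)) :* (B :- (con 1ℚ :+ Q)) :* ((con 1ℚ :+ Q) :* y)
         := (con 1ℚ :+ (con 1ℚ :+ Q)) :* (:- ((B :- Q) :* (B :- Q :- con 1ℚ)) :* y)) refl B Q y ⟩
  (1ℚ + (1ℚ + Q)) * (- ((B - Q) * (B - Q - 1ℚ)) * y)
    ≡⟨ cong₂ _*_ (trans (cong (λ z → 1ℚ + z) (sym (ι-suc q))) (sym (ι-suc p))) (sym (J-rec b q)) ⟩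
  P′ * (P′ * P * y′)
    ≡⟨ solve 3 (λ P P′ y → P′ :* (P′ :* P :* y) := P :* (P′ :* (P′ :* y))) refl P P′ y′ ⟩
  P * (P′ * (P′ * y′)) ∎))))
  where
  B Q P P′ x x′ y y′ z z′ : ℚ
  B = ι b
  Q = ι q
  P = ι p
  P′ = ι (suc p)
  x = I b 1 p
  x′ = I b 1 (suc p)
  y = J b p
  y′ = J b (suc p)
  z = I b 0 p
  z′ = I b 0 (suc p)

[1+r]J′ : ∀ b p → deriv (J b) p + (r· deriv (J b)) p ≡ I b 1 p + ι b * J b p
[1+r]J′ b zero      = solve 1 (λ B → con 1ℚ :* con 1ℚ :+ con 0ℚ := con 1ℚ :+ B :* con 0ℚ) refl (ι b)
[1+r]J′ b p@(suc q) = ι-cancelˡ p (begin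
  P * (P′ * y′ + P * y)
    ≡⟨ solve 4 (λ P P′ y y′ → P :* (P′ :* y′ :+ P :* y) := P′ :* P :* y′ :+ P :* P :* y) refl P P′ y y′ ⟩
  P′ * P * y′ + P * P * y
    ≡⟨ cong₂ (λ u v → u + v * v * y) (J-rec b q) (ι-suc q) ⟩
  - ((B - Q) * (B - Q - 1ℚ)) * y + (1ℚ + Q) * (1ℚ + Q) * y
    ≡⟨ solve 3 (λ B Q y →
         :- ((B :- Q) :* (B :- Q :- con 1ℚ)) :* y :+ (con 1ℚ :+ Q) :* (con 1ℚ :+ Q) :* y
         := :- ((B :+ con 1ℚ) :* (B :- (con 1ℚ :+ Q))) :* y :+ (con 1ℚ :+ Q) :* (B :* y)) refl B Q y ⟩
  - ((B + 1ℚ) * (B - (1ℚ + Q))) * y + (1ℚ + Q) * (B * y)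
    ≡⟨ cong (λ P → - ((B + 1ℚ) * (B - P)) * y + P * (B * y)) (sym (ι-suc q)) ⟩
  - ((B + 1ℚ) * (B - P)) * y + P * (B * y)
    ≡⟨ cong (_+ P * (B * y)) (sym (I₁-J b p)) ⟩
  P * I b 1 p + P * (B * y)
    ≡⟨ sym (ℚₚ.*-distribˡ-+ P (I b 1 p) (B * y)) ⟩
  P * (I b 1 p + B * y) ∎)
  where
  B Q P P′ y y′ : ℚ
  B = ι b
  Q = ι q
  P = ι p
  P′ = ι (suc p)
  y = J b p
  y′ = J b (suc p)

I-contiguous : ∀ b ℓ p → (1ℚ + ι ℓ + ι b - ι p) * (ι ℓ - ι b) * I b (suc ℓ) p
                       ≡ (ι ℓ - ι b + ι p) * (1ℚ + ι ℓ + ι b) * I b ℓ p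
I-contiguous b ℓ zero =
  solve 2 (λ L B → (con 1ℚ :+ L :+ B :- con 0ℚ) :* (L :- B) :* con 1ℚ
                := (L :- B :+ con 0ℚ) :* (con 1ℚ :+ L :+ B) :* con 1ℚ) refl (ι ℓ) (ι b)
I-contiguous b ℓ (suc p) = ι-cancelˡ (suc p) (ι-cancelˡ (suc p) (begin
  P′ * (P′ * ((1ℚ + L + B - P′) * (L - B) * x′))
    ≡⟨ solve 3 (λ P c x → P :* (P :* (c :* x)) := c :* (P :* P :* x)) refl P′ ((1ℚ + L + B - P′) * (L - B)) x′ ⟩
  (1ℚ + L + B - P′) * (L - B) * (P′ * P′ * x′)
    ≡⟨ cong₂ (λ u v → (1ℚ + L + B - u) * (L - B) * v) (ι-suc p)
         (trans (I-rec b (suc ℓ) p) (cong (λ l → (l * l - (B - P) * (B - P)) * x) (ι-suc ℓ))) ⟩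
  (1ℚ + L + B - (1ℚ + P)) * (L - B) * (((1ℚ + L) * (1ℚ + L) - (B - P) * (B - P)) * x)
    ≡⟨ solve 4 (λ L B P x →
         (con 1ℚ :+ L :+ B :- (con 1ℚ :+ P)) :* (L :- B)
           :* (((con 1ℚ :+ L) :* (con 1ℚ :+ L) :- (B :- P) :* (B :- P)) :* x)
         := (L :+ B :- P) :* (con 1ℚ :+ L :- B :+ P) :* ((con 1ℚ :+ L :+ B :- P) :* (L :- B) :* x))
         refl L B P x ⟩
  (L + B - P) * (1ℚ + L - B + P) * ((1ℚ + L + B - P) * (L - B) * x)
    ≡⟨ cong ((L + B - P) * (1ℚ + L - B + P) *_) (I-contiguous b ℓ p) ⟩
  (L + B - P) * (1ℚ + L - B + P) * ((L - B + P) * (1ℚ + L + B) * y)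
    ≡⟨ solve 4 (λ L B P y →
         (L :+ B :- P) :* (con 1ℚ :+ L :- B :+ P) :* ((L :- B :+ P) :* (con 1ℚ :+ L :+ B) :* y)
         := (L :- B :+ (con 1ℚ :+ P)) :* (con 1ℚ :+ L :+ B) :* ((L :* L :- (B :- P) :* (B :- P)) :* y))
         refl L B P y ⟩
  (L - B + (1ℚ + P)) * (1ℚ + L + B) * ((L * L - (B - P) * (B - P)) * y)
    ≡⟨ cong₂ (λ u v → (L - B + u) * (1ℚ + L + B) * v) (sym (ι-suc p)) (sym (I-rec b ℓ p)) ⟩
  (L - B + P′) * (1ℚ + L + B) * (P′ * P′ * y′)
    ≡⟨ solve 3 (λ P c x → c :* (P :* P :* x) := P :* (P :* (c :* x))) refl P′ ((L - B + P′) * (1ℚ + L + B)) y′ ⟩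
  P′ * (P′ * ((L - B + P′) * (1ℚ + L + B) * y′)) ∎))
  where
  L B P P′ x x′ y y′ : ℚ
  L = ι ℓ
  B = ι b
  P = ι p
  P′ = ι (suc p)
  x = I b (suc ℓ) p
  x′ = I b (suc ℓ) (suc p)
  y = I b ℓ p
  y′ = I b ℓ (suc p)

-- The third identity telescopes: the differences of defect in ℓ are single
-- terms 2k I_k, and defect vanishes at ℓ = b.

defect : ℕ → ℕ → ℚ [[r]]
defect b ℓ p = deriv (I b ℓ) p + (r· deriv (I b ℓ)) p - (ι b - ι ℓ) * I b ℓ p

defect-suc : ∀ b ℓ p → defect b (suc ℓ) p ≡ defect b ℓ p + ι (2 ℕ.* suc ℓ) * I b (suc ℓ) p
defect-suc b ℓ p = ι-cancelˡ (suc p) (begin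
  P′ * (P′ * x′ + (r· deriv (I b (suc ℓ))) p - (B - ι (suc ℓ)) * x)
    ≡⟨ cong₂ (λ u v → P′ * (P′ * x′ + u - (B - v) * x)) (r·deriv (I b (suc ℓ)) p) (ι-suc ℓ) ⟩
  P′ * (P′ * x′ + P * x - (B - (1ℚ + L)) * x)
    ≡⟨ solve 6 (λ L B P P′ x x′ →
         P′ :* (P′ :* x′ :+ P :* x :- (B :- (con 1ℚ :+ L)) :* x)
         := P′ :* P′ :* x′ :+ P′ :* (P :* x :- (B :- (con 1ℚ :+ L)) :* x)) refl L B P P′ x x′ ⟩
  P′ * P′ * x′ + P′ * (P * x - (B - (1ℚ + L)) * x)
    ≡⟨ cong₂ (λ u v → u + v * (P * x - (B - (1ℚ + L)) * x))
         (trans (I-rec b (suc ℓ) p) (cong (λ l → (l * l - (B - P) * (B - P)) * x) (ι-suc ℓ))) (ι-suc p) ⟩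
  ((1ℚ + L) * (1ℚ + L) - (B - P) * (B - P)) * x + (1ℚ + P) * (P * x - (B - (1ℚ + L)) * x)
    ≡⟨ solve 4 (λ L B P x →
         ((con 1ℚ :+ L) :* (con 1ℚ :+ L) :- (B :- P) :* (B :- P)) :* x
           :+ (con 1ℚ :+ P) :* (P :* x :- (B :- (con 1ℚ :+ L)) :* x)
         := (con 1ℚ :+ L :+ B :- P) :* (L :- B) :* x
           :+ (con 1ℚ :+ P) :* ((con 1ℚ :+ con 1ℚ) :* (con 1ℚ :+ L) :* x)) refl L B P x ⟩
  (1ℚ + L + B - P) * (L - B) * x + (1ℚ + P) * ((1ℚ + 1ℚ) * (1ℚ + L) * x)
    ≡⟨ cong (_+ (1ℚ + P) * ((1ℚ + 1ℚ) * (1ℚ + L) * x)) (I-contiguous b ℓ p) ⟩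
  (L - B + P) * (1ℚ + L + B) * y + (1ℚ + P) * ((1ℚ + 1ℚ) * (1ℚ + L) * x)
    ≡⟨ solve 5 (λ L B P x y →
         (L :- B :+ P) :* (con 1ℚ :+ L :+ B) :* y :+ (con 1ℚ :+ P) :* ((con 1ℚ :+ con 1ℚ) :* (con 1ℚ :+ L) :* x)
         := (L :* L :- (B :- P) :* (B :- P)) :* y
           :+ (con 1ℚ :+ P) :* (P :* y :- (B :- L) :* y :+ (con 1ℚ :+ con 1ℚ) :* (con 1ℚ :+ L) :* x))
         refl L B P x y ⟩
  (L * L - (B - P) * (B - P)) * y + (1ℚ + P) * (P * y - (B - L) * y + (1ℚ + 1ℚ) * (1ℚ + L) * x)
    ≡⟨ cong₂ (λ u v → u + v * (P * y - (B - L) * y + (1ℚ + 1ℚ) * (1ℚ + L) * x))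
         (sym (I-rec b ℓ p)) (sym (ι-suc p)) ⟩
  P′ * P′ * y′ + P′ * (P * y - (B - L) * y + (1ℚ + 1ℚ) * (1ℚ + L) * x)
    ≡⟨ solve 7 (λ L B P P′ x y y′ →
         P′ :* P′ :* y′ :+ P′ :* (P :* y :- (B :- L) :* y :+ (con 1ℚ :+ con 1ℚ) :* (con 1ℚ :+ L) :* x)
         := P′ :* (P′ :* y′ :+ P :* y :- (B :- L) :* y :+ (con 1ℚ :+ con 1ℚ) :* (con 1ℚ :+ L) :* x))
         refl L B P P′ x y y′ ⟩
  P′ * (P′ * y′ + P * y - (B - L) * y + (1ℚ + 1ℚ) * (1ℚ + L) * x)
    ≡⟨ cong₂ (λ u v → P′ * (P′ * y′ + u - (B - L) * y + v * x)) (sym (r·deriv (I b ℓ) p))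
         (trans (cong ((1ℚ + 1ℚ) *_) (sym (ι-suc ℓ))) (sym (ι-* 2 (suc ℓ)))) ⟩
  P′ * (defect b ℓ p + ι (2 ℕ.* suc ℓ) * x) ∎)
  where
  L B P P′ x x′ y y′ : ℚ
  L = ι ℓ
  B = ι b
  P = ι p
  P′ = ι (suc p)
  x = I b (suc ℓ) p
  x′ = I b (suc ℓ) (suc p)
  y = I b ℓ p
  y′ = I b ℓ (suc p)

∑2kI : ℕ → ℕ → ℚ [[r]]
∑2kI b n p = ∑< n λ k → ι (2 ℕ.* suc k) * I b (suc k) p

defect≡∑ : ∀ b ℓ p → defect b ℓ p ≡ defect b 0 p + ∑2kI b ℓ p
defect≡∑ b zero    p = sym (ℚₚ.+-identityʳ _)
defect≡∑ b (suc ℓ) p = begin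
  defect b (suc ℓ) p                                   ≡⟨ defect-suc b ℓ p ⟩
  defect b ℓ p + f ℓ                                   ≡⟨ cong (_+ f ℓ) (defect≡∑ b ℓ p) ⟩
  defect b 0 p + ∑2kI b ℓ p + f ℓ                      ≡⟨ ℚₚ.+-assoc (defect b 0 p) (∑2kI b ℓ p) (f ℓ) ⟩
  defect b 0 p + (∑2kI b ℓ p + f ℓ)                    ≡⟨ cong (λ z → defect b 0 p + z) (sym (∑<-snoc ℓ f)) ⟩
  defect b 0 p + ∑2kI b (suc ℓ) p                      ∎
  where
  f : ℕ → ℚ
  f k = ι (2 ℕ.* suc k) * I b (suc k) p

-- I(b,b;r) = 1, since the factor m = 0 vanishes.

I-diag : ∀ b p → I b b (suc p) ≡ 0ℚ
I-diag b p = ι-cancelˡ (suc p) (ι-cancelˡ (suc p) (begin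
  P′ * (P′ * I b b (suc p))        ≡⟨ sym (ℚₚ.*-assoc P′ P′ (I b b (suc p))) ⟩
  P′ * P′ * I b b (suc p)          ≡⟨ I-rec b b p ⟩
  (B * B - (B - ι p) * (B - ι p)) * I b b p
                                   ≡⟨ vanishes p ⟩
  0ℚ                               ≡⟨ solve 1 (λ P → con 0ℚ := P :* (P :* con 0ℚ)) refl P′ ⟩
  P′ * (P′ * 0ℚ)                   ∎))
  where
  B P′ : ℚ
  B = ι b
  P′ = ι (suc p)
  vanishes : ∀ p → (B * B - (B - ι p) * (B - ι p)) * I b b p ≡ 0ℚ
  vanishes zero    = solve 1 (λ B → (B :* B :- (B :- con 0ℚ) :* (B :- con 0ℚ)) :* con 1ℚ := con 0ℚ) refl B
  vanishes (suc p) = trans (cong ((B * B - (B - ι (suc p)) * (B - ι (suc p))) *_) (I-diag b p))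
    (ℚₚ.*-zeroʳ (B * B - (B - ι (suc p)) * (B - ι (suc p))))

defect-diag : ∀ b p → defect b b p ≡ 0ℚ
defect-diag b p = begin
  ι (suc p) * I b b (suc p) + (r· deriv (I b b)) p - (ι b - ι b) * I b b p
    ≡⟨ cong₂ (λ u v → ι (suc p) * u + v - (ι b - ι b) * I b b p) (I-diag b p) (vanishes p) ⟩
  ι (suc p) * 0ℚ + 0ℚ - (ι b - ι b) * I b b p
    ≡⟨ solve 3 (λ P B x → P :* con 0ℚ :+ con 0ℚ :- (B :- B) :* x := con 0ℚ) refl (ι (suc p)) (ι b) (I b b p) ⟩
  0ℚ ∎
  where
  vanishes : ∀ p → (r· deriv (I b b)) p ≡ 0ℚ
  vanishes zero    = refl
  vanishes (suc p) = trans (cong (ι (suc p) *_) (I-diag b p)) (ℚₚ.*-zeroʳ (ι (suc p)))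

[1+r]I′ : ∀ b ℓ p → - ι ℓ * I b ℓ p + ∑2kI b ℓ p - ∑2kI b b p
                  ≡ deriv (I b ℓ) p + (r· deriv (I b ℓ)) p - ι b * I b ℓ p
[1+r]I′ b ℓ p = begin
  - L * x + S ℓ - S b
    ≡⟨ solve 5 (λ L x e s t → :- L :* x :+ s :- t := (e :+ s) :- (e :+ t) :- L :* x) refl L x (defect b 0 p) (S ℓ) (S b) ⟩
  (defect b 0 p + S ℓ) - (defect b 0 p + S b) - L * x
    ≡⟨ cong₂ (λ u v → u - v - L * x) (sym (defect≡∑ b ℓ p)) (trans (sym (defect≡∑ b b p)) (defect-diag b p)) ⟩
  defect b ℓ p - 0ℚ - L * x
    ≡⟨ solve 5 (λ L B x d e → d :+ e :- (B :- L) :* x :- con 0ℚ :- L :* x := d :+ e :- B :* x) refl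
         L (ι b) x (deriv (I b ℓ) p) ((r· deriv (I b ℓ)) p) ⟩
  deriv (I b ℓ) p + (r· deriv (I b ℓ)) p - ι b * x ∎
  where
  L x : ℚ
  L = ι ℓ
  x = I b ℓ p
  S : ℕ → ℚ
  S n = ∑2kI b n p

-- The algebra of power series

∑<-cong-< : ∀ n {f g : ℕ → ℚ} → (∀ i → i < n → f i ≡ g i) → ∑< n f ≡ ∑< n g
∑<-cong-< zero    f≗g = refl
∑<-cong-< (suc n) f≗g = cong₂ _+_ (f≗g 0 ℕ.z<s) (∑<-cong-< n (λ i i<n → f≗g (suc i) (s≤s i<n)))

∑<-+ : ∀ n f g → ∑< n (λ i → f i + g i) ≡ ∑< n f + ∑< n g
∑<-+ n f g = ∑ℚ.∑-distrib-+ {n} (f ∘ toℕ) (g ∘ toℕ)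

∑<-* : ∀ n c f → ∑< n (λ i → c * f i) ≡ c * ∑< n f
∑<-* n c f = sym (∑ℚ.*-distribˡ-sum {n} c (f ∘ toℕ))

-1* : ∀ x → - 1ℚ * x ≡ - x
-1* = solve 1 (λ x → con (- 1ℚ) :* x := :- x) refl

∑<-minus : ∀ n f g → ∑< n (λ i → f i - g i) ≡ ∑< n f - ∑< n g
∑<-minus n f g = trans (∑<-+ n f (-_ ∘ g)) (cong (λ z → ∑< n f + z)
  (trans (∑<-cong n (λ i → sym (-1* (g i)))) (trans (∑<-* n (- 1ℚ) g) (-1* (∑< n g)))))

∑<-zero : ∀ n {f : ℕ → ℚ} → (∀ i → i < n → f i ≡ 0ℚ) → ∑< n f ≡ 0ℚ
∑<-zero n f≗0 = trans (∑<-cong-< n f≗0) (∑ℚ.sum-replicate-zero n)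

∑<-truncate : ∀ {n N f} → n ≤ N → (∀ p → n ≤ p → f p ≡ 0ℚ) → ∑< N f ≡ ∑< n f
∑<-truncate {N = N} z≤n       f≗0 = ∑<-zero N (λ p _ → f≗0 p z≤n)
∑<-truncate {f = f} (s≤s n≤N) f≗0 = cong (λ z → f 0 + z) (∑<-truncate n≤N (λ p n≤p → f≗0 (suc p) (s≤s n≤p)))

mulᶜ-cong≤ : ∀ m {F F′ G G′} →
             (∀ m′ → degree m′ ≤ degree m → F m′ ≡ F′ m′) →
             (∀ m′ → degree m′ ≤ degree m → G m′ ≡ G′ m′) →
             mulᶜ F G m ≡ mulᶜ F′ G′ m
mulᶜ-cong≤ []      F≗F′ G≗G′ = cong₂ _*_ (F≗F′ [] z≤n) (G≗G′ [] z≤n)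
mulᶜ-cong≤ (a ∷ m) F≗F′ G≗G′ = ∑<-cong-< (suc a) λ i i≤a → mulᶜ-cong≤ m
  (λ m′ m′≤m → F≗F′ (i ∷ m′) (ℕₚ.+-mono-≤ (ℕ.s≤s⁻¹ i≤a) m′≤m))
  (λ m′ m′≤m → G≗G′ ((a ∸ i) ∷ m′) (ℕₚ.+-mono-≤ (ℕₚ.m∸n≤m a i) m′≤m))

mulᶜ-cong : ∀ {F F′ G G′} → F ≗ F′ → G ≗ G′ → mulᶜ F G ≗ mulᶜ F′ G′
mulᶜ-cong F≗F′ G≗G′ m = mulᶜ-cong≤ m (λ m′ _ → F≗F′ m′) (λ m′ _ → G≗G′ m′)

mulᶜ-congˡ : ∀ {F F′} G → F ≗ F′ → mulᶜ F G ≗ mulᶜ F′ G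
mulᶜ-congˡ G F≗F′ = mulᶜ-cong {G = G} F≗F′ (λ _ → refl)

mulᶜ-congʳ : ∀ F {G G′} → G ≗ G′ → mulᶜ F G ≗ mulᶜ F G′
mulᶜ-congʳ F G≗G′ = mulᶜ-cong {F = F} (λ _ → refl) G≗G′

mulᶜ-cong-∷ : ∀ F F′ G → (∀ i m → F (i ∷ m) ≡ F′ (i ∷ m)) →
              ∀ a m → mulᶜ F G (a ∷ m) ≡ mulᶜ F′ G (a ∷ m)
mulᶜ-cong-∷ F F′ G F≗F′ a m = ∑<-cong (suc a) λ i → mulᶜ-congˡ (G ∘ ((a ∸ i) ∷_)) (F≗F′ i) m

mulᶜ-zeroˡ : ∀ G m → mulᶜ (λ _ → 0ℚ) G m ≡ 0ℚ
mulᶜ-zeroˡ G []      = ℚₚ.*-zeroˡ (G [])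
mulᶜ-zeroˡ G (a ∷ m) = ∑<-zero (suc a) (λ i _ → mulᶜ-zeroˡ (G ∘ ((a ∸ i) ∷_)) m)

mulᶜ-distribʳ : ∀ F F′ G m → mulᶜ (λ m → F m + F′ m) G m ≡ mulᶜ F G m + mulᶜ F′ G m
mulᶜ-distribʳ F F′ G []      = ℚₚ.*-distribʳ-+ (G []) (F []) (F′ [])
mulᶜ-distribʳ F F′ G (a ∷ m) = trans
  (∑<-cong (suc a) λ i → mulᶜ-distribʳ (F ∘ (i ∷_)) (F′ ∘ (i ∷_)) (G ∘ ((a ∸ i) ∷_)) m)
  (∑<-+ (suc a) (λ i → mulᶜ (F ∘ (i ∷_)) (G ∘ ((a ∸ i) ∷_)) m)
                (λ i → mulᶜ (F′ ∘ (i ∷_)) (G ∘ ((a ∸ i) ∷_)) m))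

mulᶜ-scaleˡ : ∀ c F G m → mulᶜ (λ m → c * F m) G m ≡ c * mulᶜ F G m
mulᶜ-scaleˡ c F G []      = ℚₚ.*-assoc c (F []) (G [])
mulᶜ-scaleˡ c F G (a ∷ m) = trans
  (∑<-cong (suc a) λ i → mulᶜ-scaleˡ c (F ∘ (i ∷_)) (G ∘ ((a ∸ i) ∷_)) m)
  (∑<-* (suc a) c (λ i → mulᶜ (F ∘ (i ∷_)) (G ∘ ((a ∸ i) ∷_)) m))

mulᶜ-minusˡ : ∀ F F′ G m → mulᶜ (λ m → F m - F′ m) G m ≡ mulᶜ F G m - mulᶜ F′ G m
mulᶜ-minusˡ F F′ G m = trans (mulᶜ-distribʳ F (-_ ∘ F′) G m) (cong (λ z → mulᶜ F G m + z)
  (trans (mulᶜ-congˡ G (λ m → sym (-1* (F′ m))) m) (trans (mulᶜ-scaleˡ (- 1ℚ) F′ G m) (-1* (mulᶜ F′ G m)))))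

mulᶜ-∑ˡ : ∀ n (F : ℕ → Coefficients) G m →
          mulᶜ (λ m → ∑< n λ p → F p m) G m ≡ ∑< n λ p → mulᶜ (F p) G m
mulᶜ-∑ˡ zero    F G m = mulᶜ-zeroˡ G m
mulᶜ-∑ˡ (suc n) F G m = trans
  (mulᶜ-distribʳ (F 0) (λ m → ∑< n λ p → F (suc p) m) G m)
  (cong (λ z → mulᶜ (F 0) G m + z) (mulᶜ-∑ˡ n (F ∘ suc) G m))

-- By definition, mulᶜ F G (suc a ∷ m) is
-- mulᶜ (F ∘ (0 ∷_)) (G ∘ (suc a ∷_)) m + mulᶜ (F ∘ raise 0) G (a ∷ m).
-- This is the mirror image.

mulᶜ-sucʳ : ∀ a m F G → mulᶜ F G (suc a ∷ m)
          ≡ mulᶜ F (G ∘ raise 0) (a ∷ m) + mulᶜ (F ∘ (suc a ∷_)) (G ∘ (0 ∷_)) m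
mulᶜ-sucʳ zero m F G =
  solve 2 (λ x y → x :+ (y :+ con 0ℚ) := x :+ con 0ℚ :+ y) refl
    (mulᶜ (F ∘ (0 ∷_)) (G ∘ (1 ∷_)) m) (mulᶜ (F ∘ (1 ∷_)) (G ∘ (0 ∷_)) m)
mulᶜ-sucʳ (suc a) m F G = trans
  (cong (λ z → mulᶜ (F ∘ (0 ∷_)) (G ∘ (suc (suc a) ∷_)) m + z) (mulᶜ-sucʳ a m (F ∘ raise 0) G))
  (sym (ℚₚ.+-assoc (mulᶜ (F ∘ (0 ∷_)) (G ∘ (suc (suc a) ∷_)) m) _ _))

mulᶜ-comm : ∀ m F G → mulᶜ F G m ≡ mulᶜ G F m
mulᶜ-comm []          F G = ℚₚ.*-comm (F []) (G [])
mulᶜ-comm (zero ∷ m)  F G = cong (_+ 0ℚ) (mulᶜ-comm m (F ∘ (0 ∷_)) (G ∘ (0 ∷_)))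
mulᶜ-comm (suc a ∷ m) F G = begin
  mulᶜ (F ∘ (0 ∷_)) (G ∘ (suc a ∷_)) m + mulᶜ (F ∘ raise 0) G (a ∷ m)
    ≡⟨ cong₂ _+_ (mulᶜ-comm m (F ∘ (0 ∷_)) (G ∘ (suc a ∷_))) (mulᶜ-comm (a ∷ m) (F ∘ raise 0) G) ⟩
  mulᶜ (G ∘ (suc a ∷_)) (F ∘ (0 ∷_)) m + mulᶜ G (F ∘ raise 0) (a ∷ m)
    ≡⟨ ℚₚ.+-comm (mulᶜ (G ∘ (suc a ∷_)) (F ∘ (0 ∷_)) m) _ ⟩
  mulᶜ G (F ∘ raise 0) (a ∷ m) + mulᶜ (G ∘ (suc a ∷_)) (F ∘ (0 ∷_)) m
    ≡⟨ sym (mulᶜ-sucʳ a m G F) ⟩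
  mulᶜ G F (suc a ∷ m) ∎

mulᶜ-zeroʳ : ∀ F m → mulᶜ F (λ _ → 0ℚ) m ≡ 0ℚ
mulᶜ-zeroʳ F m = trans (mulᶜ-comm m F _) (mulᶜ-zeroˡ F m)

mulᶜ-distribˡ : ∀ F G G′ m → mulᶜ F (λ m → G m + G′ m) m ≡ mulᶜ F G m + mulᶜ F G′ m
mulᶜ-distribˡ F G G′ m = trans (mulᶜ-comm m F _)
  (trans (mulᶜ-distribʳ G G′ F m) (cong₂ _+_ (mulᶜ-comm m G F) (mulᶜ-comm m G′ F)))

mulᶜ-scaleʳ : ∀ c F G m → mulᶜ F (λ m → c * G m) m ≡ c * mulᶜ F G m
mulᶜ-scaleʳ c F G m = trans (mulᶜ-comm m F _)
  (trans (mulᶜ-scaleˡ c G F m) (cong (c *_) (mulᶜ-comm m G F)))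

mulᶜ-minusʳ : ∀ F G G′ m → mulᶜ F (λ m → G m - G′ m) m ≡ mulᶜ F G m - mulᶜ F G′ m
mulᶜ-minusʳ F G G′ m = trans (mulᶜ-comm m F _)
  (trans (mulᶜ-minusˡ G G′ F m) (cong₂ _-_ (mulᶜ-comm m G F) (mulᶜ-comm m G′ F)))

mulᶜ-∑ʳ : ∀ n F (G : ℕ → Coefficients) m →
          mulᶜ F (λ m → ∑< n λ p → G p m) m ≡ ∑< n λ p → mulᶜ F (G p) m
mulᶜ-∑ʳ n F G m = trans (mulᶜ-comm m F _)
  (trans (mulᶜ-∑ˡ n G F m) (∑<-cong n λ p → mulᶜ-comm m (G p) F))

-- Multiplication by a series c that does not involve the first variable.

tailMulᶜ : Coefficients → Coefficients → Coefficients
tailMulᶜ c G []      = 0ℚ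
tailMulᶜ c G (i ∷ m) = mulᶜ c (G ∘ (i ∷_)) m

mulᶜ-assoc : ∀ m F G H → mulᶜ (mulᶜ F G) H m ≡ mulᶜ F (mulᶜ G H) m
mulᶜ-assoc []         F G H = ℚₚ.*-assoc (F []) (G []) (H [])
mulᶜ-assoc (zero ∷ m) F G H = cong (_+ 0ℚ) (begin
  mulᶜ (λ m → mulᶜ F₀ G₀ m + 0ℚ) H₀ m   ≡⟨ mulᶜ-congˡ H₀ (λ m → ℚₚ.+-identityʳ (mulᶜ F₀ G₀ m)) m ⟩
  mulᶜ (mulᶜ F₀ G₀) H₀ m                ≡⟨ mulᶜ-assoc m F₀ G₀ H₀ ⟩
  mulᶜ F₀ (mulᶜ G₀ H₀) m                ≡⟨ mulᶜ-congʳ F₀ (λ m → sym (ℚₚ.+-identityʳ (mulᶜ G₀ H₀ m))) m ⟩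
  mulᶜ F₀ (λ m → mulᶜ G₀ H₀ m + 0ℚ) m   ∎)
  where
  F₀ G₀ H₀ : Coefficients
  F₀ = F ∘ (0 ∷_)
  G₀ = G ∘ (0 ∷_)
  H₀ = H ∘ (0 ∷_)
mulᶜ-assoc (suc a ∷ m) F G H = begin
  mulᶜ (λ m → mulᶜ F₀ G₀ m + 0ℚ) H₁ m + mulᶜ (mulᶜ F G ∘ raise 0) H (a ∷ m)
    ≡⟨ cong₂ _+_
         (trans (mulᶜ-congˡ H₁ (λ m → ℚₚ.+-identityʳ (mulᶜ F₀ G₀ m)) m) (mulᶜ-assoc m F₀ G₀ H₁))
         (trans (mulᶜ-cong-∷ (mulᶜ F G ∘ raise 0) (λ m → tailMulᶜ F₀ G⁺ m + mulᶜ F⁺ G m) H (λ _ _ → refl) a m)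
           (trans (mulᶜ-distribʳ (tailMulᶜ F₀ G⁺) (mulᶜ F⁺ G) H (a ∷ m))
                  (cong₂ _+_ tail-assoc (mulᶜ-assoc (a ∷ m) F⁺ G H)))) ⟩
  mulᶜ F₀ (mulᶜ G₀ H₁) m + (mulᶜ F₀ (mulᶜ G⁺ H ∘ (a ∷_)) m + mulᶜ F⁺ (mulᶜ G H) (a ∷ m))
    ≡⟨ sym (ℚₚ.+-assoc (mulᶜ F₀ (mulᶜ G₀ H₁) m) _ _) ⟩
  mulᶜ F₀ (mulᶜ G₀ H₁) m + mulᶜ F₀ (mulᶜ G⁺ H ∘ (a ∷_)) m + mulᶜ F⁺ (mulᶜ G H) (a ∷ m)
    ≡⟨ cong (_+ mulᶜ F⁺ (mulᶜ G H) (a ∷ m)) (sym (mulᶜ-distribˡ F₀ (mulᶜ G₀ H₁) (mulᶜ G⁺ H ∘ (a ∷_)) m)) ⟩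
  mulᶜ F (mulᶜ G H) (suc a ∷ m) ∎
  where
  F₀ F⁺ G₀ G⁺ H₁ : Coefficients
  F₀ = F ∘ (0 ∷_)
  F⁺ = F ∘ raise 0
  G₀ = G ∘ (0 ∷_)
  G⁺ = G ∘ raise 0
  H₁ = H ∘ (suc a ∷_)
  tail-assoc : mulᶜ (tailMulᶜ F₀ G⁺) H (a ∷ m) ≡ mulᶜ F₀ (mulᶜ G⁺ H ∘ (a ∷_)) m
  tail-assoc = trans
    (∑<-cong (suc a) λ i → mulᶜ-assoc m F₀ (G⁺ ∘ (i ∷_)) (H ∘ ((a ∸ i) ∷_)))
    (sym (mulᶜ-∑ʳ (suc a) F₀ (λ i → mulᶜ (G⁺ ∘ (i ∷_)) (H ∘ ((a ∸ i) ∷_))) m))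

constᶜ-zero : ∀ m → constᶜ 0ℚ m ≡ 0ℚ
constᶜ-zero []          = refl
constᶜ-zero (zero  ∷ m) = constᶜ-zero m
constᶜ-zero (suc _ ∷ m) = refl

mulᶜ-constˡ : ∀ c G m → mulᶜ (constᶜ c) G m ≡ c * G m
mulᶜ-constˡ c G []      = refl
mulᶜ-constˡ c G (a ∷ m) = trans
  (cong₂ _+_ (mulᶜ-constˡ c (G ∘ (a ∷_)) m)
             (∑<-zero a (λ i _ → mulᶜ-zeroˡ (G ∘ ((a ∸ suc i) ∷_)) m)))
  (ℚₚ.+-identityʳ (c * G (a ∷ m)))

-- The filtration by degree is multiplicative.  The offsets e, e′ carry the
-- exponents of the variables already split off.

mulᶜ-order : ∀ m e e′ s t {F G} →
             (∀ m′ → e ℕ.+ degree m′ < s → F m′ ≡ 0ℚ) →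
             (∀ m′ → e′ ℕ.+ degree m′ < t → G m′ ≡ 0ℚ) →
             e ℕ.+ e′ ℕ.+ degree m < s ℕ.+ t → mulᶜ F G m ≡ 0ℚ
mulᶜ-order [] e e′ s t {F} {G} F≗0 G≗0 e+e′<s+t with e ℕₚ.<? s
... | yes e<s = trans
  (cong (_* G []) (F≗0 [] (subst (_< s) (sym (ℕₚ.+-identityʳ e)) e<s))) (ℚₚ.*-zeroˡ (G []))
... | no  e≮s = trans
  (cong (F [] *_) (G≗0 [] (subst (_< t) (sym (ℕₚ.+-identityʳ e′)) e′<t))) (ℚₚ.*-zeroʳ (F []))
  where
  e′<t : e′ < t
  e′<t = ℕₚ.≰⇒> λ t≤e′ → ℕₚ.<⇒≱ (subst (_< s ℕ.+ t) (ℕₚ.+-identityʳ (e ℕ.+ e′)) e+e′<s+t)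
    (ℕₚ.+-mono-≤ (ℕₚ.≮⇒≥ e≮s) t≤e′)
mulᶜ-order (a ∷ m) e e′ s t F≗0 G≗0 h = ∑<-zero (suc a) λ i i≤a →
  mulᶜ-order m (e ℕ.+ i) (e′ ℕ.+ (a ∸ i)) s t
    (λ m′ h′ → F≗0 (i ∷ m′) (subst (_< s) (ℕₚ.+-assoc e i (degree m′)) h′))
    (λ m′ h′ → G≗0 ((a ∸ i) ∷ m′) (subst (_< t) (ℕₚ.+-assoc e′ (a ∸ i) (degree m′)) h′))
    (subst (_< s ℕ.+ t) (sym (regroup i (ℕ.s≤s⁻¹ i≤a))) h)
  where
  regroup : ∀ i → i ≤ a → e ℕ.+ i ℕ.+ (e′ ℕ.+ (a ∸ i)) ℕ.+ degree m ≡ e ℕ.+ e′ ℕ.+ (a ℕ.+ degree m)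
  regroup i i≤a = begin
    e ℕ.+ i ℕ.+ (e′ ℕ.+ (a ∸ i)) ℕ.+ degree m
      ≡⟨ cong (ℕ._+ degree m) (ℕ-+.interchange e i e′ (a ∸ i)) ⟩
    e ℕ.+ e′ ℕ.+ (i ℕ.+ (a ∸ i)) ℕ.+ degree m
      ≡⟨ cong (λ z → e ℕ.+ e′ ℕ.+ z ℕ.+ degree m) (ℕₚ.m+[n∸m]≡n i≤a) ⟩
    e ℕ.+ e′ ℕ.+ a ℕ.+ degree m
      ≡⟨ ℕₚ.+-assoc (e ℕ.+ e′) a (degree m) ⟩
    e ℕ.+ e′ ℕ.+ (a ℕ.+ degree m) ∎

shiftᶜ-+ : ∀ ℓ F G m → shiftᶜ ℓ (λ m → F m + G m) m ≡ shiftᶜ ℓ F m + shiftᶜ ℓ G m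
shiftᶜ-+ zero    F G []          = refl
shiftᶜ-+ (suc ℓ) F G []          = refl
shiftᶜ-+ zero    F G (zero  ∷ m) = refl
shiftᶜ-+ zero    F G (suc a ∷ m) = refl
shiftᶜ-+ (suc ℓ) F G (a ∷ m)     = shiftᶜ-+ ℓ (F ∘ (a ∷_)) (G ∘ (a ∷_)) m

shiftᶜ-scale : ∀ c ℓ F m → shiftᶜ ℓ (λ m → c * F m) m ≡ c * shiftᶜ ℓ F m
shiftᶜ-scale c zero    F []          = sym (ℚₚ.*-zeroʳ c)
shiftᶜ-scale c (suc ℓ) F []          = sym (ℚₚ.*-zeroʳ c)
shiftᶜ-scale c zero    F (zero  ∷ m) = sym (ℚₚ.*-zeroʳ c)
shiftᶜ-scale c zero    F (suc a ∷ m) = refl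
shiftᶜ-scale c (suc ℓ) F (a ∷ m)     = shiftᶜ-scale c ℓ (F ∘ (a ∷_)) m

∑x̂ᶜ-+ : ∀ F G m → ∑x̂ᶜ (λ ℓ m → F ℓ m + G ℓ m) m ≡ ∑x̂ᶜ F m + ∑x̂ᶜ G m
∑x̂ᶜ-+ F G m = trans (∑<-cong (length m) λ ℓ → shiftᶜ-+ ℓ (F ℓ) (G ℓ) m)
  (∑<-+ (length m) (λ ℓ → shiftᶜ ℓ (F ℓ) m) (λ ℓ → shiftᶜ ℓ (G ℓ) m))

∑x̂ᶜ-scale : ∀ c F m → ∑x̂ᶜ (λ ℓ m → c * F ℓ m) m ≡ c * ∑x̂ᶜ F m
∑x̂ᶜ-scale c F m = trans (∑<-cong (length m) λ ℓ → shiftᶜ-scale c ℓ (F ℓ) m)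
  (∑<-* (length m) c (λ ℓ → shiftᶜ ℓ (F ℓ) m))

∑x̂ᶜ-cong≤ : ∀ m {F G : ℕ → Coefficients} →
            (∀ ℓ m′ → degree m′ ≤ degree m → F ℓ m′ ≡ G ℓ m′) → ∑x̂ᶜ F m ≡ ∑x̂ᶜ G m
∑x̂ᶜ-cong≤ []      F≗G = refl
∑x̂ᶜ-cong≤ (a ∷ m) {F} {G} F≗G = cong₂ _+_ (head a F≗G)
  (∑x̂ᶜ-cong≤ m λ ℓ m′ m′≤m → F≗G (suc ℓ) (a ∷ m′) (ℕₚ.+-monoʳ-≤ a m′≤m))
  where
  head : ∀ a → (∀ ℓ m′ → degree m′ ≤ degree (a ∷ m) → F ℓ m′ ≡ G ℓ m′) →
         shiftᶜ 0 (F 0) (a ∷ m) ≡ shiftᶜ 0 (G 0) (a ∷ m)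
  head zero    F≗G = refl
  head (suc a) F≗G = F≗G 0 (a ∷ m) (ℕₚ.n≤1+n (degree (a ∷ m)))

∑x̂ᶜ-cong : ∀ {F G : ℕ → Coefficients} → (∀ ℓ → F ℓ ≗ G ℓ) → ∑x̂ᶜ F ≗ ∑x̂ᶜ G
∑x̂ᶜ-cong F≗G m = ∑x̂ᶜ-cong≤ m (λ ℓ m′ _ → F≗G ℓ m′)

∑x̂ᶜ-minus : ∀ F G m → ∑x̂ᶜ (λ ℓ m → F ℓ m - G ℓ m) m ≡ ∑x̂ᶜ F m - ∑x̂ᶜ G m
∑x̂ᶜ-minus F G m = trans (∑x̂ᶜ-+ F (λ ℓ → -_ ∘ G ℓ) m) (cong (λ z → ∑x̂ᶜ F m + z)
  (trans (∑x̂ᶜ-cong (λ ℓ m → sym (-1* (G ℓ m))) m) (trans (∑x̂ᶜ-scale (- 1ℚ) G m) (-1* (∑x̂ᶜ G m)))))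

∑x̂ᶜ-zero : ∀ m → ∑x̂ᶜ (λ _ _ → 0ℚ) m ≡ 0ℚ
∑x̂ᶜ-zero m = trans (∑x̂ᶜ-scale 0ℚ (λ _ _ → 0ℚ) m) (ℚₚ.*-zeroˡ (∑x̂ᶜ (λ _ _ → 0ℚ) m))

∑x̂ᶜ-∑ : ∀ n (F : ℕ → ℕ → Coefficients) m →
        ∑x̂ᶜ (λ ℓ m → ∑< n λ i → F i ℓ m) m ≡ ∑< n λ i → ∑x̂ᶜ (F i) m
∑x̂ᶜ-∑ zero    F m = ∑x̂ᶜ-zero m
∑x̂ᶜ-∑ (suc n) F m = trans (∑x̂ᶜ-+ (F 0) (λ ℓ m → ∑< n λ i → F (suc i) ℓ m) m)
  (cong (λ z → ∑x̂ᶜ (F 0) m + z) (∑x̂ᶜ-∑ n (F ∘ suc) m))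

mulᶜ-shiftᶜ₀ : ∀ F G a m → mulᶜ (shiftᶜ 0 F) G (a ∷ m) ≡ shiftᶜ 0 (mulᶜ F G) (a ∷ m)
mulᶜ-shiftᶜ₀ F G zero    m = cong (_+ 0ℚ) (mulᶜ-zeroˡ (G ∘ (0 ∷_)) m)
mulᶜ-shiftᶜ₀ F G (suc a) m = trans
  (cong (_+ mulᶜ F G (a ∷ m)) (mulᶜ-zeroˡ (G ∘ (suc a ∷_)) m))
  (ℚₚ.+-identityˡ (mulᶜ F G (a ∷ m)))

mulᶜ-∑x̂ˡ : ∀ F G m → mulᶜ (∑x̂ᶜ F) G m ≡ ∑x̂ᶜ (λ ℓ → mulᶜ (F ℓ) G) m
mulᶜ-∑x̂ˡ F G []      = ℚₚ.*-zeroˡ (G [])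
mulᶜ-∑x̂ˡ F G (a ∷ m) = begin
  mulᶜ (∑x̂ᶜ F) G (a ∷ m)
    ≡⟨ ∑<-cong (suc a) (λ i → mulᶜ-distribʳ (shiftᶜ 0 (F 0) ∘ (i ∷_)) (∑x̂ᶜ (F′ i)) (G′ i) m) ⟩
  ∑< (suc a) (λ i → mulᶜ (shiftᶜ 0 (F 0) ∘ (i ∷_)) (G′ i) m + mulᶜ (∑x̂ᶜ (F′ i)) (G′ i) m)
    ≡⟨ ∑<-+ (suc a) (λ i → mulᶜ (shiftᶜ 0 (F 0) ∘ (i ∷_)) (G′ i) m) (λ i → mulᶜ (∑x̂ᶜ (F′ i)) (G′ i) m) ⟩
  mulᶜ (shiftᶜ 0 (F 0)) G (a ∷ m) + ∑< (suc a) (λ i → mulᶜ (∑x̂ᶜ (F′ i)) (G′ i) m)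
    ≡⟨ cong₂ _+_ (mulᶜ-shiftᶜ₀ (F 0) G a m)
         (trans (∑<-cong (suc a) λ i → mulᶜ-∑x̂ˡ (F′ i) (G′ i) m)
                (sym (∑x̂ᶜ-∑ (suc a) (λ i ℓ → mulᶜ (F′ i ℓ) (G′ i)) m))) ⟩
  ∑x̂ᶜ (λ ℓ → mulᶜ (F ℓ) G) (a ∷ m) ∎
  where
  F′ : ℕ → ℕ → Coefficients
  F′ i ℓ = F (suc ℓ) ∘ (i ∷_)
  G′ : ℕ → Coefficients
  G′ i = G ∘ ((a ∸ i) ∷_)

mulᶜ-∑x̂ʳ : ∀ F G m → mulᶜ F (∑x̂ᶜ G) m ≡ ∑x̂ᶜ (λ ℓ → mulᶜ F (G ℓ)) m
mulᶜ-∑x̂ʳ F G m = trans (mulᶜ-comm m F (∑x̂ᶜ G))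
  (trans (mulᶜ-∑x̂ˡ G F m) (∑x̂ᶜ-cong (λ ℓ m → mulᶜ-comm m (G ℓ) F) m))

-- Differentiation of products and of x̂-linear combinations

∂ᶜ₀-mulᶜ : ∀ a m F G → ∂ᶜ 0 (mulᶜ F G) (a ∷ m)
         ≡ mulᶜ (∂ᶜ 0 F) G (a ∷ m) + mulᶜ F (∂ᶜ 0 G) (a ∷ m)
∂ᶜ₀-mulᶜ zero m F G = begin
  1ℚ * (mulᶜ F₀ G₁ m + (mulᶜ F₁ G₀ m + 0ℚ))
    ≡⟨ solve 2 (λ x y → con 1ℚ :* (x :+ (y :+ con 0ℚ)) := (con 1ℚ :* y :+ con 0ℚ) :+ (con 1ℚ :* x :+ con 0ℚ)) refl
         (mulᶜ F₀ G₁ m) (mulᶜ F₁ G₀ m) ⟩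
  (1ℚ * mulᶜ F₁ G₀ m + 0ℚ) + (1ℚ * mulᶜ F₀ G₁ m + 0ℚ)
    ≡⟨ cong₂ (λ u v → (u + 0ℚ) + (v + 0ℚ)) (sym (mulᶜ-scaleˡ 1ℚ F₁ G₀ m)) (sym (mulᶜ-scaleʳ 1ℚ F₀ G₁ m)) ⟩
  mulᶜ (∂ᶜ 0 F) G (0 ∷ m) + mulᶜ F (∂ᶜ 0 G) (0 ∷ m) ∎
  where
  F₀ F₁ G₀ G₁ : Coefficients
  F₀ = F ∘ (0 ∷_)
  F₁ = F ∘ (1 ∷_)
  G₀ = G ∘ (0 ∷_)
  G₁ = G ∘ (1 ∷_)
∂ᶜ₀-mulᶜ (suc a) m F G = begin
  ι (suc (suc a)) * (x + y)
    ≡⟨ cong (_* (x + y)) (ι-suc (suc a)) ⟩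
  (1ℚ + n) * (x + y)
    ≡⟨ solve 3 (λ n x y → (con 1ℚ :+ n) :* (x :+ y) := (con 1ℚ :+ n) :* x :+ n :* y :+ y) refl n x y ⟩
  (1ℚ + n) * x + n * y + y
    ≡⟨ cong₂ (λ u v → u * x + v + y) (sym (ι-suc (suc a))) (∂ᶜ₀-mulᶜ a m F⁺ G) ⟩
  ι (suc (suc a)) * x + (z + w) + (u + v)
    ≡⟨ solve 5 (λ x z w u v → x :+ (z :+ w) :+ (u :+ v) := (con 1ℚ :* u :+ (z :+ v)) :+ (x :+ w)) refl
         (ι (suc (suc a)) * x) z w u v ⟩
  (1ℚ * u + (z + v)) + (ι (suc (suc a)) * x + w)
    ≡⟨ cong₂ _+_
         (cong₂ _+_ (sym (mulᶜ-scaleˡ 1ℚ (F ∘ (1 ∷_)) (G ∘ (suc a ∷_)) m)) (sym ∂F⁺))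
         (cong (_+ w) (sym (mulᶜ-scaleʳ (ι (suc (suc a))) (F ∘ (0 ∷_)) (G ∘ (suc (suc a) ∷_)) m))) ⟩
  mulᶜ (∂ᶜ 0 F) G (suc a ∷ m) + mulᶜ F (∂ᶜ 0 G) (suc a ∷ m) ∎
  where
  F⁺ : Coefficients
  F⁺ = F ∘ raise 0
  n x y z w u v : ℚ
  n = ι (suc a)
  x = mulᶜ (F ∘ (0 ∷_)) (G ∘ (suc (suc a) ∷_)) m
  y = mulᶜ F⁺ G (suc a ∷ m)
  z = mulᶜ (∂ᶜ 0 F⁺) G (a ∷ m)
  w = mulᶜ F⁺ (∂ᶜ 0 G) (a ∷ m)
  u = mulᶜ (F ∘ (1 ∷_)) (G ∘ (suc a ∷_)) m
  v = mulᶜ (F⁺ ∘ raise 0) G (a ∷ m)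
  ∂F⁺ : mulᶜ (∂ᶜ 0 F ∘ raise 0) G (a ∷ m) ≡ z + v
  ∂F⁺ = trans
    (mulᶜ-cong-∷ (∂ᶜ 0 F ∘ raise 0) (λ m → ∂ᶜ 0 F⁺ m + (F⁺ ∘ raise 0) m) G (λ i m → trans (cong (_* F (suc (suc i) ∷ m)) (ι-suc (suc i)))
      (solve 2 (λ n x → (con 1ℚ :+ n) :* x := n :* x :+ x) refl (ι (suc i)) (F (suc (suc i) ∷ m)))) a m)
    (mulᶜ-distribʳ (∂ᶜ 0 F⁺) (F⁺ ∘ raise 0) G (a ∷ m))

∂ᶜ-mulᶜ : ∀ k {F G} → Padded F → Padded G →
          ∀ m → ∂ᶜ k (mulᶜ F G) m ≡ mulᶜ (∂ᶜ k F) G m + mulᶜ F (∂ᶜ k G) m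
∂ᶜ-mulᶜ-∷ : ∀ k {F G} → Padded F → Padded G → ∀ a m →
            ∂ᶜ k (mulᶜ F G) (a ∷ m) ≡ mulᶜ (∂ᶜ k F) G (a ∷ m) + mulᶜ F (∂ᶜ k G) (a ∷ m)
∂ᶜ-mulᶜ k F-pad G-pad (a ∷ m) = ∂ᶜ-mulᶜ-∷ k F-pad G-pad a m
∂ᶜ-mulᶜ k {F} {G} F-pad G-pad [] = begin
  ∂ᶜ k (mulᶜ F G) []
    ≡⟨ sym (∂ᶜ-pad k {mulᶜ F G} (mulᶜ-pad F-pad G-pad) []) ⟩
  ∂ᶜ k (mulᶜ F G) (0 ∷ [])
    ≡⟨ ∂ᶜ-mulᶜ-∷ k F-pad G-pad 0 [] ⟩
  mulᶜ (∂ᶜ k F) G (0 ∷ []) + mulᶜ F (∂ᶜ k G) (0 ∷ [])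
    ≡⟨ cong₂ _+_ (mulᶜ-pad {∂ᶜ k F} {G} (∂ᶜ-pad k F-pad) G-pad [])
                 (mulᶜ-pad {F} {∂ᶜ k G} F-pad (∂ᶜ-pad k G-pad) []) ⟩
  mulᶜ (∂ᶜ k F) G [] + mulᶜ F (∂ᶜ k G) [] ∎
∂ᶜ-mulᶜ-∷ zero    {F} {G} F-pad G-pad a m = ∂ᶜ₀-mulᶜ a m F G
∂ᶜ-mulᶜ-∷ (suc k) {F} {G} F-pad G-pad a m = begin
  e * ∑< (suc a) (λ i → mulᶜ (F ∘ (i ∷_)) (G ∘ ((a ∸ i) ∷_)) (raise k m))
    ≡⟨ sym (∑<-* (suc a) e (λ i → mulᶜ (F ∘ (i ∷_)) (G ∘ ((a ∸ i) ∷_)) (raise k m))) ⟩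
  ∑< (suc a) (λ i → ∂ᶜ k (mulᶜ (F ∘ (i ∷_)) (G ∘ ((a ∸ i) ∷_))) m)
    ≡⟨ ∑<-cong (suc a) (λ i → ∂ᶜ-mulᶜ k (F-pad ∘ (i ∷_)) (G-pad ∘ ((a ∸ i) ∷_)) m) ⟩
  _
    ≡⟨ ∑<-+ (suc a) (λ i → mulᶜ (∂ᶜ k (F ∘ (i ∷_))) (G ∘ ((a ∸ i) ∷_)) m)
                    (λ i → mulᶜ (F ∘ (i ∷_)) (∂ᶜ k (G ∘ ((a ∸ i) ∷_))) m) ⟩
  mulᶜ (∂ᶜ (suc k) F) G (a ∷ m) + mulᶜ F (∂ᶜ (suc k) G) (a ∷ m) ∎
  where
  e : ℚ
  e = ι (suc (exponent k m))

∂ᶜ-∑x̂ᶜ : ∀ k {F} → (∀ ℓ → Padded (F ℓ)) →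
         ∀ m → ∂ᶜ k (∑x̂ᶜ F) m ≡ F k m + ∑x̂ᶜ (λ ℓ → ∂ᶜ k (F ℓ)) m
∂ᶜ-∑x̂ᶜ-∷ : ∀ k {F} → (∀ ℓ → Padded (F ℓ)) →
           ∀ a m → ∂ᶜ k (∑x̂ᶜ F) (a ∷ m) ≡ F k (a ∷ m) + ∑x̂ᶜ (λ ℓ → ∂ᶜ k (F ℓ)) (a ∷ m)
∂ᶜ-∑x̂ᶜ k F-pad (a ∷ m) = ∂ᶜ-∑x̂ᶜ-∷ k F-pad a m
∂ᶜ-∑x̂ᶜ k {F} F-pad [] = begin
  ∂ᶜ k (∑x̂ᶜ F) []       ≡⟨ sym (∂ᶜ-pad k (∑x̂ᶜ-pad F-pad) []) ⟩
  ∂ᶜ k (∑x̂ᶜ F) (0 ∷ []) ≡⟨ ∂ᶜ-∑x̂ᶜ-∷ k F-pad 0 [] ⟩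
  F k (0 ∷ []) + _      ≡⟨ cong₂ _+_ (F-pad k []) (∑x̂ᶜ-pad {λ ℓ → ∂ᶜ k (F ℓ)} (λ ℓ → ∂ᶜ-pad k (F-pad ℓ)) []) ⟩
  F k [] + 0ℚ           ∎
∂ᶜ-∑x̂ᶜ-∷ zero {F} F-pad a m = begin
  ι (suc a) * (F 0 (a ∷ m) + ∑x̂ᶜ F′ m)
    ≡⟨ ℚₚ.*-distribˡ-+ (ι (suc a)) (F 0 (a ∷ m)) (∑x̂ᶜ F′ m) ⟩
  ι (suc a) * F 0 (a ∷ m) + ι (suc a) * ∑x̂ᶜ F′ m
    ≡⟨ cong₂ _+_ (head a) (sym (∑x̂ᶜ-scale (ι (suc a)) F′ m)) ⟩
  F 0 (a ∷ m) + shiftᶜ 0 (∂ᶜ 0 (F 0)) (a ∷ m) + ∑x̂ᶜ (λ ℓ m → ι (suc a) * F′ ℓ m) m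
    ≡⟨ ℚₚ.+-assoc (F 0 (a ∷ m)) _ _ ⟩
  F 0 (a ∷ m) + ∑x̂ᶜ (λ ℓ → ∂ᶜ 0 (F ℓ)) (a ∷ m) ∎
  where
  F′ : ℕ → Coefficients
  F′ ℓ = F (suc ℓ) ∘ (suc a ∷_)
  head : ∀ a → ι (suc a) * F 0 (a ∷ m) ≡ F 0 (a ∷ m) + shiftᶜ 0 (∂ᶜ 0 (F 0)) (a ∷ m)
  head zero    = solve 1 (λ x → con 1ℚ :* x := x :+ con 0ℚ) refl (F 0 (0 ∷ m))
  head (suc a) = trans (cong (_* F 0 (suc a ∷ m)) (ι-suc (suc a)))
    (solve 2 (λ n x → (con 1ℚ :+ n) :* x := x :+ n :* x) refl (ι (suc a)) (F 0 (suc a ∷ m)))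
∂ᶜ-∑x̂ᶜ-∷ (suc k) {F} F-pad a m = begin
  e * (shiftᶜ 0 (F 0) (a ∷ raise k m) + ∑x̂ᶜ F′ (raise k m))
    ≡⟨ ℚₚ.*-distribˡ-+ e (shiftᶜ 0 (F 0) (a ∷ raise k m)) (∑x̂ᶜ F′ (raise k m)) ⟩
  e * shiftᶜ 0 (F 0) (a ∷ raise k m) + ∂ᶜ k (∑x̂ᶜ F′) m
    ≡⟨ cong₂ _+_ (head a) (∂ᶜ-∑x̂ᶜ k {F′} (λ ℓ → F-pad (suc ℓ) ∘ (a ∷_)) m) ⟩
  s + (F (suc k) (a ∷ m) + t)
    ≡⟨ solve 3 (λ s x t → s :+ (x :+ t) := x :+ (s :+ t)) refl s (F (suc k) (a ∷ m)) t ⟩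
  F (suc k) (a ∷ m) + (s + t) ∎
  where
  F′ : ℕ → Coefficients
  F′ ℓ = F (suc ℓ) ∘ (a ∷_)
  e s t : ℚ
  e = ι (suc (exponent k m))
  s = shiftᶜ 0 (∂ᶜ (suc k) (F 0)) (a ∷ m)
  t = ∑x̂ᶜ (λ ℓ → ∂ᶜ k (F′ ℓ)) m
  head : ∀ a → e * shiftᶜ 0 (F 0) (a ∷ raise k m) ≡ shiftᶜ 0 (∂ᶜ (suc k) (F 0)) (a ∷ m)
  head zero    = ℚₚ.*-zeroʳ e
  head (suc a) = refl

∂ᶜ-constᶜ : ∀ k c m → ∂ᶜ k (constᶜ c) m ≡ 0ℚ
∂ᶜ-constᶜ k c m = trans (cong (ι (suc (exponent k m)) *_) (vanishes k m))
  (ℚₚ.*-zeroʳ (ι (suc (exponent k m))))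
  where
  vanishes : ∀ k m → constᶜ c (raise k m) ≡ 0ℚ
  vanishes zero    []          = refl
  vanishes zero    (a ∷ m)     = refl
  vanishes (suc k) []          = vanishes k []
  vanishes (suc k) (zero ∷ m)  = vanishes k m
  vanishes (suc k) (suc a ∷ m) = refl

-- Units and substitution into scalar series

padded-degree-zero : ∀ m {F} → Padded F → degree m ≡ 0 → F m ≡ F []
padded-degree-zero []         F-pad d≡0 = refl
padded-degree-zero (zero ∷ m) F-pad d≡0 =
  trans (padded-degree-zero m (F-pad ∘ (0 ∷_)) d≡0) (F-pad [])

mulᶜ-unit-zero : ∀ {U} F → Padded U → U [] ≡ 1ℚ →
                 (∀ m → mulᶜ U F m ≡ 0ℚ) → ∀ m → F m ≡ 0ℚ
mulᶜ-unit-zero {U} F U-pad U₀≡1 UF≗0 m = vanishes (suc (degree m)) m ℕₚ.≤-refl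
  where
  V : Coefficients
  V m = constᶜ 1ℚ m - U m
  V-pad : Padded V
  V-pad m = cong₂ _-_ (constᶜ-pad 1ℚ m) (U-pad m)
  V-order : ∀ m → degree m < 1 → V m ≡ 0ℚ
  V-order m d<1 = trans (padded-degree-zero m V-pad (ℕₚ.n<1⇒n≡0 d<1)) (cong (λ z → 1ℚ - z) U₀≡1)
  vanishes : ∀ n m → degree m < n → F m ≡ 0ℚ
  vanishes (suc n) m (s≤s d≤n) = begin
    F m
      ≡⟨ solve 1 (λ x → x := con 1ℚ :* x :- con 0ℚ) refl (F m) ⟩
    1ℚ * F m - 0ℚ
      ≡⟨ cong₂ _-_ (sym (mulᶜ-constˡ 1ℚ F m)) (sym (UF≗0 m)) ⟩
    mulᶜ (constᶜ 1ℚ) F m - mulᶜ U F m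
      ≡⟨ sym (mulᶜ-minusˡ (constᶜ 1ℚ) U F m) ⟩
    mulᶜ V F m
      ≡⟨ mulᶜ-order m 0 0 1 n V-order (vanishes n) (s≤s d≤n) ⟩
    0ℚ ∎

mulᶜ-unit-cancelˡ : ∀ {U} F G → Padded U → U [] ≡ 1ℚ → mulᶜ U F ≗ mulᶜ U G → F ≗ G
mulᶜ-unit-cancelˡ {U} F G U-pad U₀≡1 UF≗UG m = begin
  F m               ≡⟨ solve 2 (λ x y → x := x :- y :+ y) refl (F m) (G m) ⟩
  F m - G m + G m   ≡⟨ cong (_+ G m) (mulᶜ-unit-zero (λ m → F m - G m) U-pad U₀≡1 U[F-G]≗0 m) ⟩
  0ℚ + G m          ≡⟨ ℚₚ.+-identityˡ (G m) ⟩
  G m               ∎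
  where
  U[F-G]≗0 : ∀ m → mulᶜ U (λ m → F m - G m) m ≡ 0ℚ
  U[F-G]≗0 m = trans (mulᶜ-minusʳ U F G m)
    (trans (cong (_- mulᶜ U G m) (UF≗UG m)) (ℚₚ.+-inverseʳ (mulᶜ U G m)))

degree-raise : ∀ k m → degree (raise k m) ≡ suc (degree m)
degree-raise zero    []      = refl
degree-raise zero    (a ∷ m) = refl
degree-raise (suc k) []      = degree-raise k []
degree-raise (suc k) (a ∷ m) = trans (cong (a ℕ.+_) (degree-raise k m)) (ℕₚ.+-suc a (degree m))

^ˢ-order : ∀ R → constantTerm R ≡ 0ℚ → ∀ p m → degree m < p → coeff (R ^ˢ p) m ≡ 0ℚ
^ˢ-order R R₀≡0 (suc p) m d<1+p = mulᶜ-order m 0 0 1 p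
  (λ m′ d<1 → trans (padded-degree-zero m′ (pad R) (ℕₚ.n<1⇒n≡0 d<1)) R₀≡0)
  (^ˢ-order R R₀≡0 p) d<1+p

∂-^ˢ : ∀ k R p m → ∂ᶜ k (coeff (R ^ˢ suc p)) m ≡ ι (suc p) * mulᶜ (coeff (R ^ˢ p)) (∂ᶜ k (coeff R)) m
∂-^ˢ k R p m = begin
  ∂ᶜ k (coeff (R ^ˢ suc p)) m
    ≡⟨ ∂ᶜ-mulᶜ k (pad R) (pad (R ^ˢ p)) m ⟩
  mulᶜ ∂R (coeff (R ^ˢ p)) m + mulᶜ (coeff R) (∂ᶜ k (coeff (R ^ˢ p))) m
    ≡⟨ cong₂ _+_ (mulᶜ-comm m ∂R (coeff (R ^ˢ p))) (rest p) ⟩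
  x + ι p * x
    ≡⟨ solve 2 (λ n x → x :+ n :* x := (con 1ℚ :+ n) :* x) refl (ι p) x ⟩
  (1ℚ + ι p) * x
    ≡⟨ cong (_* x) (sym (ι-suc p)) ⟩
  ι (suc p) * x ∎
  where
  ∂R : Coefficients
  ∂R = ∂ᶜ k (coeff R)
  x : ℚ
  x = mulᶜ (coeff (R ^ˢ p)) ∂R m
  rest : ∀ p → mulᶜ (coeff R) (∂ᶜ k (coeff (R ^ˢ p))) m ≡ ι p * mulᶜ (coeff (R ^ˢ p)) ∂R m
  rest zero = begin
    mulᶜ (coeff R) (∂ᶜ k (constᶜ 1ℚ)) m   ≡⟨ mulᶜ-congʳ (coeff R) (∂ᶜ-constᶜ k 1ℚ) m ⟩
    mulᶜ (coeff R) (λ _ → 0ℚ) m           ≡⟨ mulᶜ-zeroʳ (coeff R) m ⟩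
    0ℚ                                    ≡⟨ sym (ℚₚ.*-zeroˡ (mulᶜ (constᶜ 1ℚ) ∂R m)) ⟩
    0ℚ * mulᶜ (constᶜ 1ℚ) ∂R m            ∎
  rest (suc p) = begin
    mulᶜ (coeff R) (∂ᶜ k (coeff (R ^ˢ suc p))) m
      ≡⟨ mulᶜ-congʳ (coeff R) (∂-^ˢ k R p) m ⟩
    mulᶜ (coeff R) (λ m → ι (suc p) * mulᶜ (coeff (R ^ˢ p)) ∂R m) m
      ≡⟨ mulᶜ-scaleʳ (ι (suc p)) (coeff R) (mulᶜ (coeff (R ^ˢ p)) ∂R) m ⟩
    ι (suc p) * mulᶜ (coeff R) (mulᶜ (coeff (R ^ˢ p)) ∂R) m
      ≡⟨ cong (ι (suc p) *_) (sym (mulᶜ-assoc m (coeff R) (coeff (R ^ˢ p)) ∂R)) ⟩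
    ι (suc p) * mulᶜ (coeff (R ^ˢ suc p)) ∂R m ∎

eval : PowerSeries → ℚ [[r]] → PowerSeries
eval R a = (const ∘ a) ⟦r≔ R ⟧

evalᶜ : PowerSeries → ℚ [[r]] → Coefficients
evalᶜ R a = coeff (eval R a)

evalᶜ-sum : ∀ R a m → evalᶜ R a m ≡ ∑< (suc (degree m)) λ p → a p * coeff (R ^ˢ p) m
evalᶜ-sum R a m = ∑<-cong (suc (degree m)) λ p → mulᶜ-constˡ (a p) (coeff (R ^ˢ p)) m

evalᶜ-truncate : ∀ R → constantTerm R ≡ 0ℚ → ∀ a N m → degree m < N →
                 evalᶜ R a m ≡ ∑< N λ p → a p * coeff (R ^ˢ p) m
evalᶜ-truncate R R₀≡0 a N m d<N = trans (evalᶜ-sum R a m)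
  (sym (∑<-truncate d<N λ p d<p → trans (cong (a p *_) (^ˢ-order R R₀≡0 p m d<p)) (ℚₚ.*-zeroʳ (a p))))

evalᶜ-cong : ∀ R {a c} → a ≗ c → evalᶜ R a ≗ evalᶜ R c
evalᶜ-cong R {a} {c} a≗c m = trans (evalᶜ-sum R a m)
  (trans (∑<-cong (suc (degree m)) λ p → cong (_* coeff (R ^ˢ p) m) (a≗c p)) (sym (evalᶜ-sum R c m)))

evalᶜ-scale : ∀ R c a m → evalᶜ R (λ p → c * a p) m ≡ c * evalᶜ R a m
evalᶜ-scale R c a m = begin
  evalᶜ R (λ p → c * a p) m                                     ≡⟨ evalᶜ-sum R (λ p → c * a p) m ⟩
  ∑< (suc (degree m)) (λ p → c * a p * coeff (R ^ˢ p) m)        ≡⟨ ∑<-cong (suc (degree m)) (λ p → ℚₚ.*-assoc c (a p) (coeff (R ^ˢ p) m)) ⟩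
  ∑< (suc (degree m)) (λ p → c * (a p * coeff (R ^ˢ p) m))      ≡⟨ ∑<-* (suc (degree m)) c (λ p → a p * coeff (R ^ˢ p) m) ⟩
  c * ∑< (suc (degree m)) (λ p → a p * coeff (R ^ˢ p) m)        ≡⟨ cong (c *_) (sym (evalᶜ-sum R a m)) ⟩
  c * evalᶜ R a m                                               ∎

evalᶜ-+ : ∀ R a c m → evalᶜ R (λ p → a p + c p) m ≡ evalᶜ R a m + evalᶜ R c m
evalᶜ-+ R a c m = begin
  evalᶜ R (λ p → a p + c p) m
    ≡⟨ evalᶜ-sum R (λ p → a p + c p) m ⟩
  ∑< (suc (degree m)) (λ p → (a p + c p) * coeff (R ^ˢ p) m)
    ≡⟨ ∑<-cong (suc (degree m)) (λ p → ℚₚ.*-distribʳ-+ (coeff (R ^ˢ p) m) (a p) (c p)) ⟩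
  ∑< (suc (degree m)) (λ p → a p * coeff (R ^ˢ p) m + c p * coeff (R ^ˢ p) m)
    ≡⟨ ∑<-+ (suc (degree m)) (λ p → a p * coeff (R ^ˢ p) m) (λ p → c p * coeff (R ^ˢ p) m) ⟩
  _ ≡⟨ sym (cong₂ _+_ (evalᶜ-sum R a m) (evalᶜ-sum R c m)) ⟩
  evalᶜ R a m + evalᶜ R c m ∎

evalᶜ-minus : ∀ R a c m → evalᶜ R (λ p → a p - c p) m ≡ evalᶜ R a m - evalᶜ R c m
evalᶜ-minus R a c m = trans (evalᶜ-+ R a (-_ ∘ c) m) (cong (λ z → evalᶜ R a m + z)
  (trans (evalᶜ-cong R (λ p → sym (-1* (c p))) m) (trans (evalᶜ-scale R (- 1ℚ) c m) (-1* (evalᶜ R c m)))))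

evalᶜ-∑ : ∀ R n (a : ℕ → ℚ [[r]]) m → evalᶜ R (λ p → ∑< n λ k → a k p) m ≡ ∑< n λ k → evalᶜ R (a k) m
evalᶜ-∑ R zero    a m = trans (evalᶜ-sum R (λ _ → 0ℚ) m)
  (∑<-zero (suc (degree m)) λ p _ → ℚₚ.*-zeroˡ (coeff (R ^ˢ p) m))
evalᶜ-∑ R (suc n) a m = trans (evalᶜ-+ R (a 0) (λ p → ∑< n λ k → a (suc k) p) m)
  (cong (λ z → evalᶜ R (a 0) m + z) (evalᶜ-∑ R n (a ∘ suc) m))

mulᶜ-evalᶜ : ∀ R → constantTerm R ≡ 0ℚ → ∀ a G m →
             mulᶜ (evalᶜ R a) G m ≡ ∑< (suc (degree m)) λ p → a p * mulᶜ (coeff (R ^ˢ p)) G m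
mulᶜ-evalᶜ R R₀≡0 a G m = begin
  mulᶜ (evalᶜ R a) G m
    ≡⟨ mulᶜ-cong≤ m {G = G} (λ m′ m′≤m → evalᶜ-truncate R R₀≡0 a N m′ (s≤s m′≤m)) (λ _ _ → refl) ⟩
  mulᶜ (λ m → ∑< N λ p → a p * coeff (R ^ˢ p) m) G m
    ≡⟨ mulᶜ-∑ˡ N (λ p m → a p * coeff (R ^ˢ p) m) G m ⟩
  ∑< N (λ p → mulᶜ (λ m → a p * coeff (R ^ˢ p) m) G m)
    ≡⟨ ∑<-cong N (λ p → mulᶜ-scaleˡ (a p) (coeff (R ^ˢ p)) G m) ⟩
  ∑< N (λ p → a p * mulᶜ (coeff (R ^ˢ p)) G m) ∎
  where
  N : ℕ
  N = suc (degree m)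

evalᶜ-r· : ∀ R → constantTerm R ≡ 0ℚ → ∀ a m → evalᶜ R (r· a) m ≡ mulᶜ (coeff R) (evalᶜ R a) m
evalᶜ-r· R R₀≡0 a m = begin
  evalᶜ R (r· a) m
    ≡⟨ evalᶜ-truncate R R₀≡0 (r· a) (suc N) m (ℕₚ.m≤n⇒m≤1+n ℕₚ.≤-refl) ⟩
  0ℚ * coeff 1ˢ m + ∑< N (λ p → a p * mulᶜ (coeff R) (coeff (R ^ˢ p)) m)
    ≡⟨ solve 2 (λ x y → con 0ℚ :* x :+ y := y) refl (coeff 1ˢ m) (∑< N (λ p → a p * coeff (R ^ˢ suc p) m)) ⟩
  ∑< N (λ p → a p * mulᶜ (coeff R) (coeff (R ^ˢ p)) m)
    ≡⟨ ∑<-cong N (λ p → cong (a p *_) (mulᶜ-comm m (coeff R) (coeff (R ^ˢ p)))) ⟩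
  ∑< N (λ p → a p * mulᶜ (coeff (R ^ˢ p)) (coeff R) m)
    ≡⟨ sym (mulᶜ-evalᶜ R R₀≡0 a (coeff R) m) ⟩
  mulᶜ (evalᶜ R a) (coeff R) m
    ≡⟨ mulᶜ-comm m (evalᶜ R a) (coeff R) ⟩
  mulᶜ (coeff R) (evalᶜ R a) m ∎
  where
  N : ℕ
  N = suc (degree m)

∂-evalᶜ : ∀ k R → constantTerm R ≡ 0ℚ → ∀ a m →
          ∂ᶜ k (evalᶜ R a) m ≡ mulᶜ (evalᶜ R (deriv a)) (∂ᶜ k (coeff R)) m
∂-evalᶜ k R R₀≡0 a m = begin
  e * evalᶜ R a (raise k m)
    ≡⟨ cong (e *_) (evalᶜ-truncate R R₀≡0 a (suc N) (raise k m) (s≤s (ℕₚ.≤-reflexive (degree-raise k m)))) ⟩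
  e * ∑< (suc N) (λ p → a p * coeff (R ^ˢ p) (raise k m))
    ≡⟨ sym (∑<-* (suc N) e (λ p → a p * coeff (R ^ˢ p) (raise k m))) ⟩
  ∑< (suc N) (λ p → e * (a p * coeff (R ^ˢ p) (raise k m)))
    ≡⟨ ∑<-cong (suc N) (λ p → solve 3 (λ e x y → e :* (x :* y) := x :* (e :* y)) refl e (a p) (coeff (R ^ˢ p) (raise k m))) ⟩
  a 0 * ∂ᶜ k (constᶜ 1ℚ) m + ∑< N (λ p → a (suc p) * ∂ᶜ k (coeff (R ^ˢ suc p)) m)
    ≡⟨ cong₂ _+_ (trans (cong (a 0 *_) (∂ᶜ-constᶜ k 1ℚ m)) (ℚₚ.*-zeroʳ (a 0)))
         (∑<-cong N λ p → trans (cong (a (suc p) *_) (∂-^ˢ k R p m))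
           (solve 3 (λ x n y → x :* (n :* y) := n :* x :* y) refl (a (suc p)) (ι (suc p)) (mulᶜ (coeff (R ^ˢ p)) ∂R m))) ⟩
  0ℚ + ∑< N (λ p → deriv a p * mulᶜ (coeff (R ^ˢ p)) ∂R m)
    ≡⟨ ℚₚ.+-identityˡ _ ⟩
  ∑< N (λ p → deriv a p * mulᶜ (coeff (R ^ˢ p)) ∂R m)
    ≡⟨ sym (mulᶜ-evalᶜ R R₀≡0 (deriv a) ∂R m) ⟩
  mulᶜ (evalᶜ R (deriv a)) ∂R m ∎
  where
  N : ℕ
  N = suc (degree m)
  e : ℚ
  e = ι (suc (exponent k m))
  ∂R : Coefficients
  ∂R = ∂ᶜ k (coeff R)

Ž-eval : ∀ b R → constantTerm R ≡ 0ℚ → Ž b ⟦r≔ R ⟧ ≈ˢ eval R (J b) -ˢ ∑x̂ (eval R ∘ I b)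
Ž-eval b R R₀≡0 m = begin
  ∑< N (λ p → mulᶜ (λ m → constᶜ (J b p) m - ∑x̂ᶜ (λ ℓ → constᶜ (I b ℓ p)) m) (coeff (R ^ˢ p)) m)
    ≡⟨ ∑<-cong N (λ p → trans
         (mulᶜ-minusˡ (constᶜ (J b p)) (∑x̂ᶜ (λ ℓ → constᶜ (I b ℓ p))) (coeff (R ^ˢ p)) m)
         (cong (λ z → mulᶜ (constᶜ (J b p)) (coeff (R ^ˢ p)) m - z)
           (mulᶜ-∑x̂ˡ (λ ℓ → constᶜ (I b ℓ p)) (coeff (R ^ˢ p)) m))) ⟩
  ∑< N (λ p → mulᶜ (constᶜ (J b p)) (coeff (R ^ˢ p)) m - ∑x̂ᶜ (T p) m)
    ≡⟨ ∑<-minus N (λ p → mulᶜ (constᶜ (J b p)) (coeff (R ^ˢ p)) m) (λ p → ∑x̂ᶜ (T p) m) ⟩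
  evalᶜ R (J b) m - ∑< N (λ p → ∑x̂ᶜ (T p) m)
    ≡⟨ cong (λ z → evalᶜ R (J b) m - z) (sym (∑x̂ᶜ-∑ N T m)) ⟩
  evalᶜ R (J b) m - ∑x̂ᶜ (λ ℓ m → ∑< N λ p → T p ℓ m) m
    ≡⟨ cong (λ z → evalᶜ R (J b) m - z) (∑x̂ᶜ-cong≤ m λ ℓ m′ m′≤m → trans
         (∑<-cong N λ p → mulᶜ-constˡ (I b ℓ p) (coeff (R ^ˢ p)) m′)
         (sym (evalᶜ-truncate R R₀≡0 (I b ℓ) N m′ (s≤s m′≤m)))) ⟩
  evalᶜ R (J b) m - ∑x̂ᶜ (evalᶜ R ∘ I b) m ∎
  where
  N : ℕ
  N = suc (degree m)
  T : ℕ → ℕ → Coefficients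
  T p ℓ = mulᶜ (constᶜ (I b ℓ p)) (coeff (R ^ˢ p))

Ž′ : ℕ → PowerSeries → PowerSeries
Ž′ b R = eval R (deriv (J b)) -ˢ ∑x̂ (λ ℓ → eval R (deriv (I b ℓ)))

Ž′-constantTerm : ∀ b R → constantTerm (Ž′ b R) ≡ 1ℚ
Ž′-constantTerm b R = refl

IsŘ⇒eval : ∀ b R → IsŘ b R → ∀ m → evalᶜ R (J b) m - ∑x̂ᶜ (evalᶜ R ∘ I b) m ≡ 0ℚ
IsŘ⇒eval b R R-root m = trans (sym (Ž-eval b R (IsŘ.zeroConstantTerm R-root) m))
  (trans (IsŘ.root R-root m) (constᶜ-zero m))

Ž′-∂ : ∀ b R → IsŘ b R → ∀ k m →
       mulᶜ (coeff (Ž′ b R)) (∂ᶜ k (coeff R)) m ≡ evalᶜ R (I b k) m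
Ž′-∂ b R R-root k m = begin
  mulᶜ (coeff (Ž′ b R)) ∂R m
    ≡⟨ trans (mulᶜ-minusˡ (evalᶜ R (deriv (J b))) (∑x̂ᶜ (λ ℓ → evalᶜ R (deriv (I b ℓ)))) ∂R m)
             (cong (λ z → mulᶜ (evalᶜ R (deriv (J b))) ∂R m - z)
                   (mulᶜ-∑x̂ˡ (λ ℓ → evalᶜ R (deriv (I b ℓ))) ∂R m)) ⟩
  mulᶜ (evalᶜ R (deriv (J b))) ∂R m - ∑x̂ᶜ (λ ℓ → mulᶜ (evalᶜ R (deriv (I b ℓ))) ∂R) m
    ≡⟨ sym (cong₂ _-_ (∂-evalᶜ k R R₀≡0 (J b) m) (∑x̂ᶜ-cong (λ ℓ → ∂-evalᶜ k R R₀≡0 (I b ℓ)) m)) ⟩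
  ∂ᶜ k (evalᶜ R (J b)) m - ∑x̂ᶜ (λ ℓ → ∂ᶜ k (evalᶜ R (I b ℓ))) m
    ≡⟨ solve 3 (λ x y z → x :- z := (x :- (y :+ z)) :+ y) refl
         (∂ᶜ k (evalᶜ R (J b)) m) (evalᶜ R (I b k) m) (∑x̂ᶜ (λ ℓ → ∂ᶜ k (evalᶜ R (I b ℓ))) m) ⟩
  ∂ᶜ k (evalᶜ R (J b)) m - (evalᶜ R (I b k) m + ∑x̂ᶜ (λ ℓ → ∂ᶜ k (evalᶜ R (I b ℓ))) m) + evalᶜ R (I b k) m
    ≡⟨ cong (_+ evalᶜ R (I b k) m) ∂-root ⟩
  0ℚ + evalᶜ R (I b k) m
    ≡⟨ ℚₚ.+-identityˡ (evalᶜ R (I b k) m) ⟩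
  evalᶜ R (I b k) m ∎
  where
  R₀≡0 : constantTerm R ≡ 0ℚ
  R₀≡0 = IsŘ.zeroConstantTerm R-root
  ∂R : Coefficients
  ∂R = ∂ᶜ k (coeff R)
  e x y : ℚ
  e = ι (suc (exponent k m))
  x = evalᶜ R (J b) (raise k m)
  y = ∑x̂ᶜ (evalᶜ R ∘ I b) (raise k m)
  ∂-root : e * x - (evalᶜ R (I b k) m + ∑x̂ᶜ (λ ℓ → ∂ᶜ k (evalᶜ R (I b ℓ))) m) ≡ 0ℚ
  ∂-root = begin
    _               ≡⟨ cong (λ z → e * x - z) (sym (∂ᶜ-∑x̂ᶜ k {evalᶜ R ∘ I b} (λ ℓ → pad (eval R (I b ℓ))) m)) ⟩
    e * x - e * y   ≡⟨ solve 3 (λ e x y → e :* x :- e :* y := e :* (x :- y)) refl e x y ⟩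
    e * (x - y)     ≡⟨ cong (e *_) (IsŘ⇒eval b R R-root (raise k m)) ⟩
    e * 0ℚ          ≡⟨ ℚₚ.*-zeroʳ e ⟩
    0ℚ              ∎

Ž′-cancel : ∀ b R F G → mulᶜ (coeff (Ž′ b R)) F ≗ mulᶜ (coeff (Ž′ b R)) G → F ≗ G
Ž′-cancel b R F G = mulᶜ-unit-cancelˡ F G (pad (Ž′ b R)) (Ž′-constantTerm b R)

dilation : ∀ b R → IsŘ b R → D-dil R ≈ˢ 0ˢ
dilation b R R-root = Ž′-cancel b R (coeff (D-dil R)) (coeff 0ˢ) λ m → begin
  mulᶜ W (coeff (D-dil R)) m
    ≡⟨ trans (mulᶜ-minusʳ W (λ m → ∂R 1 m - ∂R 0 m) (∑x̂ᶜ ∂R) m)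
             (cong₂ _-_ (mulᶜ-minusʳ W (∂R 1) (∂R 0) m) (mulᶜ-∑x̂ʳ W ∂R m)) ⟩
  mulᶜ W (∂R 1) m - mulᶜ W (∂R 0) m - ∑x̂ᶜ (λ ℓ → mulᶜ W (∂R ℓ)) m
    ≡⟨ cong₂ _-_ (cong₂ _-_ (Ž′-∂ b R R-root 1 m) (Ž′-∂ b R R-root 0 m)) (∑x̂ᶜ-cong (Ž′-∂ b R R-root) m) ⟩
  evalᶜ R (I b 1) m - evalᶜ R (I b 0) m - ∑x̂ᶜ (evalᶜ R ∘ I b) m
    ≡⟨ cong (_- ∑x̂ᶜ (evalᶜ R ∘ I b) m)
         (sym (trans (evalᶜ-cong R (J≡I₁-I₀ b) m) (evalᶜ-minus R (I b 1) (I b 0) m))) ⟩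
  evalᶜ R (J b) m - ∑x̂ᶜ (evalᶜ R ∘ I b) m
    ≡⟨ IsŘ⇒eval b R R-root m ⟩
  0ℚ
    ≡⟨ sym (trans (mulᶜ-congʳ W constᶜ-zero m) (mulᶜ-zeroʳ W m)) ⟩
  mulᶜ W (coeff 0ˢ) m ∎
  where
  W : Coefficients
  W = coeff (Ž′ b R)
  ∂R : ℕ → Coefficients
  ∂R k = ∂ᶜ k (coeff R)

string : ∀ b R → IsŘ b R → D-str b R ≈ˢ 1ˢ +ˢ R
string b R R-root = Ž′-cancel b R (coeff (D-str b R)) (coeff (1ˢ +ˢ R)) λ m → begin
  mulᶜ W (coeff (D-str b R)) m
    ≡⟨ trans (mulᶜ-minusʳ W (∂R 1) (∑x̂ᶜ A) m)
             (cong₂ _-_ (Ž′-∂ b R R-root 1 m) (trans (mulᶜ-∑x̂ʳ W A m) (∑x̂ᶜ-cong WA m))) ⟩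
  evalᶜ R (I b 1) m - ∑x̂ᶜ (λ ℓ m → X ℓ m + mulᶜ (coeff R) (X ℓ) m - ι b * evalᶜ R (I b ℓ) m) m
    ≡⟨ cong₂ _-_ (eval-I₁ m) (sum-X m) ⟩
  xJ m + mulᶜ (coeff R) xJ m - ι b * evalᶜ R (J b) m
    - (∑x̂ᶜ X m + mulᶜ (coeff R) (∑x̂ᶜ X) m - ι b * ∑x̂ᶜ (evalᶜ R ∘ I b) m)
    ≡⟨ solve 7 (λ x Rx j s Rs i B → (x :+ Rx :- B :* j) :- (s :+ Rs :- B :* i)
                                 := (x :- s) :+ (Rx :- Rs) :- B :* (j :- i)) refl
         (xJ m) (mulᶜ (coeff R) xJ m) (evalᶜ R (J b) m)
         (∑x̂ᶜ X m) (mulᶜ (coeff R) (∑x̂ᶜ X) m) (∑x̂ᶜ (evalᶜ R ∘ I b) m) (ι b) ⟩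
  W m + (mulᶜ (coeff R) xJ m - mulᶜ (coeff R) (∑x̂ᶜ X) m)
    - ι b * (evalᶜ R (J b) m - ∑x̂ᶜ (evalᶜ R ∘ I b) m)
    ≡⟨ cong₂ (λ u v → W m + u - ι b * v)
         (trans (sym (mulᶜ-minusʳ (coeff R) xJ (∑x̂ᶜ X) m)) (mulᶜ-comm m (coeff R) W))
         (IsŘ⇒eval b R R-root m) ⟩
  W m + mulᶜ W (coeff R) m - ι b * 0ℚ
    ≡⟨ solve 3 (λ w x B → w :+ x :- B :* con 0ℚ := con 1ℚ :* w :+ x) refl (W m) (mulᶜ W (coeff R) m) (ι b) ⟩
  1ℚ * W m + mulᶜ W (coeff R) m
    ≡⟨ cong (_+ mulᶜ W (coeff R) m) (sym (trans (mulᶜ-comm m W (coeff 1ˢ)) (mulᶜ-constˡ 1ℚ W m))) ⟩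
  mulᶜ W (coeff 1ˢ) m + mulᶜ W (coeff R) m
    ≡⟨ sym (mulᶜ-distribˡ W (coeff 1ˢ) (coeff R) m) ⟩
  mulᶜ W (coeff (1ˢ +ˢ R)) m ∎
  where
  R₀≡0 : constantTerm R ≡ 0ℚ
  R₀≡0 = IsŘ.zeroConstantTerm R-root
  W xJ : Coefficients
  W = coeff (Ž′ b R)
  xJ = evalᶜ R (deriv (J b))
  ∂R X S A : ℕ → Coefficients
  ∂R k = ∂ᶜ k (coeff R)
  X ℓ = evalᶜ R (deriv (I b ℓ))
  S n m = ∑< n λ k → ι (2 ℕ.* suc k) * ∂R (suc k) m
  A ℓ m = - ι ℓ * ∂R ℓ m + S ℓ m - S b m
  WS : ∀ n m → mulᶜ W (S n) m ≡ evalᶜ R (∑2kI b n) m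
  WS n m = begin
    mulᶜ W (S n) m
      ≡⟨ mulᶜ-∑ʳ n W (λ k m → ι (2 ℕ.* suc k) * ∂R (suc k) m) m ⟩
    ∑< n (λ k → mulᶜ W (λ m → ι (2 ℕ.* suc k) * ∂R (suc k) m) m)
      ≡⟨ ∑<-cong n (λ k → trans (mulᶜ-scaleʳ (ι (2 ℕ.* suc k)) W (∂R (suc k)) m)
           (trans (cong (ι (2 ℕ.* suc k) *_) (Ž′-∂ b R R-root (suc k) m))
                  (sym (evalᶜ-scale R (ι (2 ℕ.* suc k)) (I b (suc k)) m)))) ⟩
    ∑< n (λ k → evalᶜ R (λ p → ι (2 ℕ.* suc k) * I b (suc k) p) m)
      ≡⟨ sym (evalᶜ-∑ R n (λ k p → ι (2 ℕ.* suc k) * I b (suc k) p) m) ⟩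
    evalᶜ R (∑2kI b n) m ∎
  1+r : ∀ a c m → evalᶜ R (λ p → deriv a p + (r· deriv a) p - ι b * c p) m
                ≡ evalᶜ R (deriv a) m + mulᶜ (coeff R) (evalᶜ R (deriv a)) m - ι b * evalᶜ R c m
  1+r a c m = trans (evalᶜ-minus R (λ p → deriv a p + (r· deriv a) p) (λ p → ι b * c p) m)
    (cong₂ _-_ (trans (evalᶜ-+ R (deriv a) (r· deriv a) m)
                      (cong (λ z → evalᶜ R (deriv a) m + z) (evalᶜ-r· R R₀≡0 (deriv a) m)))
               (evalᶜ-scale R (ι b) c m))
  WA : ∀ ℓ m → mulᶜ W (A ℓ) m ≡ X ℓ m + mulᶜ (coeff R) (X ℓ) m - ι b * evalᶜ R (I b ℓ) m
  WA ℓ m = begin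
    mulᶜ W (A ℓ) m
      ≡⟨ trans (mulᶜ-minusʳ W (λ m → - ι ℓ * ∂R ℓ m + S ℓ m) (S b) m)
           (cong₂ _-_ (trans (mulᶜ-distribˡ W (λ m → - ι ℓ * ∂R ℓ m) (S ℓ) m)
                             (cong₂ _+_ (trans (mulᶜ-scaleʳ (- ι ℓ) W (∂R ℓ) m)
                                               (cong (- ι ℓ *_) (Ž′-∂ b R R-root ℓ m)))
                                        (WS ℓ m)))
                      (WS b m)) ⟩
    - ι ℓ * evalᶜ R (I b ℓ) m + evalᶜ R (∑2kI b ℓ) m - evalᶜ R (∑2kI b b) m
      ≡⟨ sym (trans (evalᶜ-minus R (λ p → - ι ℓ * I b ℓ p + ∑2kI b ℓ p) (∑2kI b b) m)
           (cong (_- evalᶜ R (∑2kI b b) m) (trans (evalᶜ-+ R (λ p → - ι ℓ * I b ℓ p) (∑2kI b ℓ) m)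
             (cong (_+ evalᶜ R (∑2kI b ℓ) m) (evalᶜ-scale R (- ι ℓ) (I b ℓ) m))))) ⟩
    evalᶜ R (λ p → - ι ℓ * I b ℓ p + ∑2kI b ℓ p - ∑2kI b b p) m
      ≡⟨ trans (evalᶜ-cong R ([1+r]I′ b ℓ) m) (1+r (I b ℓ) (I b ℓ) m) ⟩
    X ℓ m + mulᶜ (coeff R) (X ℓ) m - ι b * evalᶜ R (I b ℓ) m ∎
  eval-I₁ : ∀ m → evalᶜ R (I b 1) m ≡ xJ m + mulᶜ (coeff R) xJ m - ι b * evalᶜ R (J b) m
  eval-I₁ m = trans
    (evalᶜ-cong R (λ p → trans
      (solve 2 (λ x y → x := x :+ y :- y) refl (I b 1 p) (ι b * J b p))
      (cong (_- ι b * J b p) (sym ([1+r]J′ b p)))) m)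
    (1+r (J b) (J b) m)
  sum-X : ∀ m → ∑x̂ᶜ (λ ℓ m → X ℓ m + mulᶜ (coeff R) (X ℓ) m - ι b * evalᶜ R (I b ℓ) m) m
              ≡ ∑x̂ᶜ X m + mulᶜ (coeff R) (∑x̂ᶜ X) m - ι b * ∑x̂ᶜ (evalᶜ R ∘ I b) m
  sum-X m = trans
    (∑x̂ᶜ-minus (λ ℓ m → X ℓ m + mulᶜ (coeff R) (X ℓ) m) (λ ℓ m → ι b * evalᶜ R (I b ℓ) m) m)
    (cong₂ _-_ (trans (∑x̂ᶜ-+ X (λ ℓ → mulᶜ (coeff R) (X ℓ)) m)
                      (cong (λ z → ∑x̂ᶜ X m + z) (sym (mulᶜ-∑x̂ʳ (coeff R) X m))))
               (∑x̂ᶜ-scale (ι b) (evalᶜ R ∘ I b) m))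

lemma19 : (b : ℕ) (R : PowerSeries) → IsŘ b R →
    (D-str b R ≈ˢ 1ˢ +ˢ R) × (D-dil R ≈ˢ 0ˢ)
lemma19 b R R-root = string b R R-root , dilation b R R-root
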